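{- Let $k\ge 2$ and let $f:\{0,1\}^k\to\mathbb R_{\ge 0}$ be symmetric, with values $w_0,\dots,w_k\in\mathbb R_{\ge0}$ such that $f(x_1,\dots,x_k)=w_\ell$ whenever $x_1+\dots+x_k=\ell$. If $f$ supports $2$-equality but neither pinning-to-$0$ nor pinning-to-$1$, then $w_\ell=w_{k-\ell}$ for all $\ell=0,\dots,k$.
   Context: A $k$-uniform hypergraph $H=(V,\mathcal F)$ consists of a finite vertex set $V$ and a set $\mathcal F$ of $k$-element subsets of $V$ (hyperedges). For a symmetric $f:\{0,1\}^k\to\mathbb R_{\ge0}$ and $\sigma:V\to\{0,1\}$ let $w_{f;H}(\sigma)=\prod_{\{v_1,\dots,v_k\}\in\mathcal F}f(\sigma(v_1),\dots,\sigma(v_k))$ and $Z_{f;H}=\sum_\sigma w_{f;H}(\sigma)$. When $Z_{f;H}>0$, $\mu_{f;H}$ is the probability distribution on configurations $\sigma:V\to\{0,1\}$ with $\mu_{f;H}(\sigma)=w_{f;H}(\sigma)/Z_{f;H}$; statements about $\mu_{f;H}$ implicitly require $Z_{f;H}>0$. Write $\sigma_v=\sigma(v)$. For $s\in\{0,1\}$, $f$ supports pinning-to-$s$ if for every $\varepsilon>0$ there is a ($k$-uniform, finite) hypergraph $H$ with a vertex $v$ such that $\mu_{f;H}(\sigma_v=s)\ge 1-\varepsilon$. For an integer $t\ge2$, $f$ supports $t$-equality if for every $\varepsilon>0$ there is a ($k$-uniform, finite) hypergraph $H$ with distinct vertices $v_1,\dots,v_t$ such that for each $s\in\{0,1\}$,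 $\mu_{f;H}(\sigma_{v_1}=\dots=\sigma_{v_t}=s)\ge(1-\varepsilon)/2$. -}

module Defs where

open import Data.Bool using (true; false)
open import Data.Fin using (Fin; zero; suc; toℕ)
open import Data.Fin.Permutation using (Permutation′; _⟨$⟩ʳ_)
import Data.Fin.Properties as Fin
open import Data.Fin.Subset using (Subset; ∣_∣)
open import Data.List as List using (List; []; _∷_)
open import Data.List.Relation.Unary.Unique.Propositional using (Unique)
open import Data.Nat as ℕ using (ℕ; zero; suc)
import Data.Nat.Properties as ℕ
open import Data.Product using (Σ-syntax; ∃; ∃-syntax; _×_; _,_; proj₁; proj₂)
open import Data.Rational as ℚ using (ℚ; 0ℚ; 1ℚ; ½)
import Data.Rational.Properties as ℚ
open import Data.Rational.Solver using (module +-*-Solver)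
open import Data.Vec as Vec using (Vec; []; _∷_; lookup; tabulate)
open import Data.Vec.Relation.Unary.All using (all?)
import Data.Vec.Relation.Unary.Unique.Propositional as Distinct
open import Relation.Binary.PropositionalEquality
  using (_≡_; refl; sym; trans; cong; cong₂; subst; subst₂)
open import Relation.Nullary using (yes; no; contradiction)
open import Relation.Unary using (Pred; Decidable)
open import Level using (0ℓ)

Eventually : (ℕ → Set) → Set
Eventually P = ∃[ N ] (∀ n → N ℕ.≤ n → P n)

IsCauchy : (ℕ → ℚ) → Set
IsCauchy x = ∀ ε → 0ℚ ℚ.< ε →
  ∃[ N ] (∀ m n → N ℕ.≤ m → N ℕ.≤ n → ℚ.∣ x m ℚ.- x n ∣ ℚ.≤ ε)

-- Cauchy sequences of rationals; equality of reals is _≃_, not _≡_.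
record ℝ : Set where
  constructor mkℝ
  field
    seq    : ℕ → ℚ
    cauchy : IsCauchy seq

open ℝ public

infix 4 _≃_ _≤_ _<_ _≥_

_≃_ : ℝ → ℝ → Set
x ≃ y = ∀ ε → 0ℚ ℚ.< ε → Eventually λ n → ℚ.∣ seq x n ℚ.- seq y n ∣ ℚ.≤ ε

_≤_ : ℝ → ℝ → Set
x ≤ y = ∀ ε → 0ℚ ℚ.< ε → Eventually λ n → seq x n ℚ.≤ seq y n ℚ.+ ε

_<_ : ℝ → ℝ → Set
x < y = ∃[ δ ] (0ℚ ℚ.< δ × Eventually λ n → seq x n ℚ.+ δ ℚ.≤ seq y n)

_≥_ : ℝ → ℝ → Set
x ≥ y = y ≤ x

module CauchyLemmas where

  0<* : ∀ {p q} → 0ℚ ℚ.< p → 0ℚ ℚ.< q → 0ℚ ℚ.< p ℚ.* q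
  0<* {p} {q} 0<p 0<q = ℚ.positive⁻¹ (p ℚ.* q)
    {{ℚ.pos*pos⇒pos p {{ℚ.positive 0<p}} q {{ℚ.positive 0<q}}}}

  0<+ : ∀ {p q} → 0ℚ ℚ.< p → 0ℚ ℚ.< q → 0ℚ ℚ.< p ℚ.+ q
  0<+ {p} {q} 0<p 0<q = ℚ.positive⁻¹ (p ℚ.+ q)
    {{ℚ.pos+pos⇒pos p {{ℚ.positive 0<p}} q {{ℚ.positive 0<q}}}}

  *-mono-≤ : ∀ {p q r s} → 0ℚ ℚ.≤ p → 0ℚ ℚ.≤ s →
             p ℚ.≤ q → r ℚ.≤ s → p ℚ.* r ℚ.≤ q ℚ.* s
  *-mono-≤ {p} {q} {r} {s} 0≤p 0≤s p≤q r≤s = ℚ.≤-trans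
    (ℚ.*-monoˡ-≤-nonNeg p {{ℚ.nonNegative 0≤p}} r≤s)
    (ℚ.*-monoʳ-≤-nonNeg s {{ℚ.nonNegative 0≤s}} p≤q)

  <⇒≢0 : ∀ {p} → 0ℚ ℚ.< p → ℚ.NonZero p
  <⇒≢0 {p} 0<p = ℚ.pos⇒nonZero p {{ℚ.positive 0<p}}

  divide : ∀ {ε b} → 0ℚ ℚ.< ε → 0ℚ ℚ.< b → ∃[ δ ] (0ℚ ℚ.< δ × δ ℚ.* b ≡ ε)
  divide {ε} {b} 0<ε 0<b = ε ℚ.* 1/b , 0<* 0<ε 0<1/b , eq
    where
    1/b = (ℚ.1/ b) {{<⇒≢0 0<b}}
    0<1/b : 0ℚ ℚ.< 1/b
    0<1/b = ℚ.positive⁻¹ 1/b {{ℚ.1/pos⇒pos b {{ℚ.positive 0<b}}}}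
    eq : ε ℚ.* 1/b ℚ.* b ≡ ε
    eq = trans (ℚ.*-assoc ε 1/b b)
      (trans (cong (ε ℚ.*_) (ℚ.*-inverseˡ b {{<⇒≢0 0<b}})) (ℚ.*-identityʳ ε))

  bounded : ∀ {x} → IsCauchy x →
            ∃[ B ] (0ℚ ℚ.< B × Eventually λ n → ℚ.∣ x n ∣ ℚ.≤ B)
  bounded {x} cx with cx 1ℚ (ℚ.positive⁻¹ 1ℚ)
  ... | N , h = ℚ.∣ x N ∣ ℚ.+ 1ℚ , 0<B , N , λ n N≤n → begin
      ℚ.∣ x n ∣                      ≡⟨ cong ℚ.∣_∣ (split (x N) (x n)) ⟩
      ℚ.∣ x N ℚ.+ (x n ℚ.- x N) ∣    ≤⟨ ℚ.∣p+q∣≤∣p∣+∣q∣ (x N) (x n ℚ.- x N) ⟩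
      ℚ.∣ x N ∣ ℚ.+ ℚ.∣ x n ℚ.- x N ∣ ≤⟨ ℚ.+-monoʳ-≤ ℚ.∣ x N ∣ (h n N N≤n ℕ.≤-refl) ⟩
      ℚ.∣ x N ∣ ℚ.+ 1ℚ               ∎
    where
    open ℚ.≤-Reasoning
    open +-*-Solver
    0<B : 0ℚ ℚ.< ℚ.∣ x N ∣ ℚ.+ 1ℚ
    0<B = ℚ.+-mono-≤-< (ℚ.0≤∣p∣ (x N)) (ℚ.positive⁻¹ 1ℚ)
    split : ∀ a b → b ≡ a ℚ.+ (b ℚ.- a)
    split = solve 2 (λ a b → b := a :+ (b :- a)) refl

  +-cauchy : ∀ {x y} → IsCauchy x → IsCauchy y → IsCauchy (λ n → x n ℚ.+ y n)
  +-cauchy {x} {y} cx cy ε 0<ε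
    with divide 0<ε (ℚ.positive⁻¹ (1ℚ ℚ.+ 1ℚ))
  ... | δ , 0<δ , 2δ≡ε with cx δ 0<δ | cy δ 0<δ
  ... | M , hx | N , hy = M ℕ.⊔ N , λ m n ≤m ≤n → begin
      ℚ.∣ (x m ℚ.+ y m) ℚ.- (x n ℚ.+ y n) ∣     ≡⟨ cong ℚ.∣_∣ (regroup (x m) (y m) (x n) (y n)) ⟩
      ℚ.∣ (x m ℚ.- x n) ℚ.+ (y m ℚ.- y n) ∣     ≤⟨ ℚ.∣p+q∣≤∣p∣+∣q∣ (x m ℚ.- x n) (y m ℚ.- y n) ⟩
      ℚ.∣ x m ℚ.- x n ∣ ℚ.+ ℚ.∣ y m ℚ.- y n ∣   ≤⟨ ℚ.+-mono-≤
          (hx m n (ℕ.m⊔n≤o⇒m≤o M N ≤m) (ℕ.m⊔n≤o⇒m≤o M N ≤n))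
          (hy m n (ℕ.m⊔n≤o⇒n≤o M N ≤m) (ℕ.m⊔n≤o⇒n≤o M N ≤n)) ⟩
      δ ℚ.+ δ                                   ≡⟨ double δ ⟩
      δ ℚ.* (1ℚ ℚ.+ 1ℚ)                         ≡⟨ 2δ≡ε ⟩
      ε                                         ∎
    where
    open ℚ.≤-Reasoning
    open +-*-Solver
    regroup : ∀ a b c d → (a ℚ.+ b) ℚ.- (c ℚ.+ d) ≡ (a ℚ.- c) ℚ.+ (b ℚ.- d)
    regroup = solve 4 (λ a b c d → (a :+ b) :- (c :+ d) := (a :- c) :+ (b :- d)) refl
    double : ∀ a → a ℚ.+ a ≡ a ℚ.* (1ℚ ℚ.+ 1ℚ)
    double = solve 1 (λ a → a :+ a := a :* (con 1ℚ :+ con 1ℚ)) refl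

  neg-cauchy : ∀ {x} → IsCauchy x → IsCauchy (λ n → ℚ.- x n)
  neg-cauchy {x} cx ε 0<ε with cx ε 0<ε
  ... | N , h = N , λ m n ≤m ≤n →
    subst (ℚ._≤ ε) (cong ℚ.∣_∣ (flip (x m) (x n))) (h n m ≤n ≤m)
    where
    open +-*-Solver
    flip : ∀ a b → b ℚ.- a ≡ ℚ.- a ℚ.- ℚ.- b
    flip = solve 2 (λ a b → b :- a := :- a :- :- b) refl

  *-close : ∀ {B C δ} (a b c d : ℚ) → 0ℚ ℚ.≤ C → 0ℚ ℚ.≤ δ →
            ℚ.∣ a ∣ ℚ.≤ B → ℚ.∣ d ∣ ℚ.≤ C →
            ℚ.∣ a ℚ.- c ∣ ℚ.≤ δ → ℚ.∣ b ℚ.- d ∣ ℚ.≤ δ →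
            ℚ.∣ a ℚ.* b ℚ.- c ℚ.* d ∣ ℚ.≤ δ ℚ.* (B ℚ.+ C)
  *-close {B} {C} {δ} a b c d 0≤C 0≤δ a≤B d≤C a-c b-d = begin
    ℚ.∣ a ℚ.* b ℚ.- c ℚ.* d ∣
      ≡⟨ cong ℚ.∣_∣ (regroup a b c d) ⟩
    ℚ.∣ a ℚ.* (b ℚ.- d) ℚ.+ (a ℚ.- c) ℚ.* d ∣
      ≤⟨ ℚ.∣p+q∣≤∣p∣+∣q∣ (a ℚ.* (b ℚ.- d)) ((a ℚ.- c) ℚ.* d) ⟩
    ℚ.∣ a ℚ.* (b ℚ.- d) ∣ ℚ.+ ℚ.∣ (a ℚ.- c) ℚ.* d ∣
      ≡⟨ cong₂ ℚ._+_ (ℚ.∣p*q∣≡∣p∣*∣q∣ a (b ℚ.- d)) (ℚ.∣p*q∣≡∣p∣*∣q∣ (a ℚ.- c) d) ⟩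
    ℚ.∣ a ∣ ℚ.* ℚ.∣ b ℚ.- d ∣ ℚ.+ ℚ.∣ a ℚ.- c ∣ ℚ.* ℚ.∣ d ∣
      ≤⟨ ℚ.+-mono-≤ (*-mono-≤ {ℚ.∣ a ∣} {B} {ℚ.∣ b ℚ.- d ∣} {δ} (ℚ.0≤∣p∣ a) 0≤δ a≤B b-d)
                    (*-mono-≤ {ℚ.∣ a ℚ.- c ∣} {δ} {ℚ.∣ d ∣} {C} (ℚ.0≤∣p∣ (a ℚ.- c)) 0≤C a-c d≤C) ⟩
    B ℚ.* δ ℚ.+ δ ℚ.* C
      ≡⟨ factor B C δ ⟩
    δ ℚ.* (B ℚ.+ C) ∎
    where
    open ℚ.≤-Reasoning
    open +-*-Solver
    regroup : ∀ a b c d → a ℚ.* b ℚ.- c ℚ.* d ≡ a ℚ.* (b ℚ.- d) ℚ.+ (a ℚ.- c) ℚ.* d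
    regroup = solve 4 (λ a b c d → a :* b :- c :* d := a :* (b :- d) :+ (a :- c) :* d) refl
    factor : ∀ a b d → a ℚ.* d ℚ.+ d ℚ.* b ≡ d ℚ.* (a ℚ.+ b)
    factor = solve 3 (λ a b d → a :* d :+ d :* b := d :* (a :+ b)) refl

  *-cauchy : ∀ {x y} → IsCauchy x → IsCauchy y → IsCauchy (λ n → x n ℚ.* y n)
  *-cauchy {x} {y} cx cy ε 0<ε = from (bounded {x} cx) (bounded {y} cy)
    where
    Goal : ℚ → Set
    Goal b = ∃[ N ] (∀ m n → N ℕ.≤ m → N ℕ.≤ n →
      ℚ.∣ x m ℚ.* y m ℚ.- x n ℚ.* y n ∣ ℚ.≤ b)
    from : ∃[ B ] (0ℚ ℚ.< B × Eventually λ n → ℚ.∣ x n ∣ ℚ.≤ B) →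
           ∃[ C ] (0ℚ ℚ.< C × Eventually λ n → ℚ.∣ y n ∣ ℚ.≤ C) → Goal ε
    from (B , 0<B , K , bx) (C , 0<C , L , by) =
      subst Goal δb≡ε (close (cx δ 0<δ) (cy δ 0<δ))
      where
      δ-spec = divide {ε} {B ℚ.+ C} 0<ε (0<+ {B} {C} 0<B 0<C)
      δ = proj₁ δ-spec
      0<δ = proj₁ (proj₂ δ-spec)
      δb≡ε = proj₂ (proj₂ δ-spec)
      close : ∃[ M ] (∀ m n → M ℕ.≤ m → M ℕ.≤ n → ℚ.∣ x m ℚ.- x n ∣ ℚ.≤ δ) →
              ∃[ N ] (∀ m n → N ℕ.≤ m → N ℕ.≤ n → ℚ.∣ y m ℚ.- y n ∣ ℚ.≤ δ) →
              Goal (δ ℚ.* (B ℚ.+ C))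
      close (M , hx) (N , hy) = (K ℕ.⊔ L) ℕ.⊔ (M ℕ.⊔ N) , λ m n ≤m ≤n →
        let ≤m₁ = ℕ.m⊔n≤o⇒m≤o (K ℕ.⊔ L) (M ℕ.⊔ N) ≤m
            ≤m₂ = ℕ.m⊔n≤o⇒n≤o (K ℕ.⊔ L) (M ℕ.⊔ N) ≤m
            ≤n₁ = ℕ.m⊔n≤o⇒m≤o (K ℕ.⊔ L) (M ℕ.⊔ N) ≤n
            ≤n₂ = ℕ.m⊔n≤o⇒n≤o (K ℕ.⊔ L) (M ℕ.⊔ N) ≤n
        in *-close {B} {C} {δ} (x m) (y m) (x n) (y n) (ℚ.<⇒≤ 0<C) (ℚ.<⇒≤ 0<δ)
             (bx m (ℕ.m⊔n≤o⇒m≤o K L ≤m₁)) (by n (ℕ.m⊔n≤o⇒n≤o K L ≤n₁))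
             (hx m n (ℕ.m⊔n≤o⇒m≤o M N ≤m₂) (ℕ.m⊔n≤o⇒m≤o M N ≤n₂))
             (hy m n (ℕ.m⊔n≤o⇒n≤o M N ≤m₂) (ℕ.m⊔n≤o⇒n≤o M N ≤n₂))

open CauchyLemmas

-- Total, so that 1/_⟨_⟩ can act termwise on sequences that are only
-- eventually positive.
recip : ℚ → ℚ
recip q with q ℚ.≟ 0ℚ
... | yes _  = 0ℚ
... | no q≢0 = (ℚ.1/ q) {{ℚ.≢-nonZero q≢0}}

recip-inverseˡ : ∀ {q} → 0ℚ ℚ.< q → recip q ℚ.* q ≡ 1ℚ
recip-inverseˡ {q} 0<q with q ℚ.≟ 0ℚ
... | yes q≡0 = contradiction (sym q≡0) (ℚ.<⇒≢ 0<q)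
... | no q≢0  = ℚ.*-inverseˡ q {{ℚ.≢-nonZero q≢0}}

fromℚ : ℚ → ℝ
fromℚ q = mkℝ (λ _ → q) λ ε 0<ε → 0 , λ _ _ _ _ →
  subst (ℚ._≤ ε) (sym (cong ℚ.∣_∣ (ℚ.+-inverseʳ q))) (ℚ.<⇒≤ 0<ε)

0ℝ 1ℝ ½ℝ : ℝ
0ℝ = fromℚ 0ℚ
1ℝ = fromℚ 1ℚ
½ℝ = fromℚ ½

infixl 6 _+_ _-_
infixl 7 _*_
infix  8 -_

_+_ : ℝ → ℝ → ℝ
x + y = mkℝ (λ n → seq x n ℚ.+ seq y n) (+-cauchy {seq x} {seq y} (cauchy x) (cauchy y))

-_ : ℝ → ℝ
- x = mkℝ (λ n → ℚ.- seq x n) (neg-cauchy {seq x} (cauchy x))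

_-_ : ℝ → ℝ → ℝ
x - y = x + - y

_*_ : ℝ → ℝ → ℝ
x * y = mkℝ (λ n → seq x n ℚ.* seq y n) (*-cauchy {seq x} {seq y} (cauchy x) (cauchy y))

private
  recip-cauchy : ∀ (x : ℝ) → 0ℝ < x → IsCauchy (λ n → recip (seq x n))
  recip-cauchy x (d , 0<d , M , d≤x) ε 0<ε
    with cauchy x (ε ℚ.* (d ℚ.* d)) (0<* 0<ε (0<* 0<d 0<d))
  ... | N , h = M ℕ.⊔ N , λ m n ≤m ≤n →
    close (lower m (ℕ.m⊔n≤o⇒m≤o M N ≤m)) (lower n (ℕ.m⊔n≤o⇒m≤o M N ≤n))
          (h n m (ℕ.m⊔n≤o⇒n≤o M N ≤n) (ℕ.m⊔n≤o⇒n≤o M N ≤m))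
    where
    open ℚ.≤-Reasoning
    open +-*-Solver
    lower : ∀ n → M ℕ.≤ n → d ℚ.≤ seq x n
    lower n M≤n = subst (ℚ._≤ seq x n) (ℚ.+-identityˡ d) (d≤x n M≤n)
    regroup : ∀ a b r s → (r ℚ.- s) ℚ.* (a ℚ.* b) ≡ (r ℚ.* a) ℚ.* b ℚ.- (s ℚ.* b) ℚ.* a
    regroup = solve 4 (λ a b r s →
      (r :- s) :* (a :* b) := (r :* a) :* b :- (s :* b) :* a) refl
    close : ∀ {a b} → d ℚ.≤ a → d ℚ.≤ b → ℚ.∣ b ℚ.- a ∣ ℚ.≤ ε ℚ.* (d ℚ.* d) →
            ℚ.∣ recip a ℚ.- recip b ∣ ℚ.≤ ε
    close {a} {b} d≤a d≤b b-a = ℚ.*-cancelʳ-≤-pos (a ℚ.* b) {{ℚ.positive 0<ab}} (begin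
      ℚ.∣ recip a ℚ.- recip b ∣ ℚ.* (a ℚ.* b)
        ≡⟨ cong (ℚ.∣ recip a ℚ.- recip b ∣ ℚ.*_) (sym (ℚ.0≤p⇒∣p∣≡p (ℚ.<⇒≤ 0<ab))) ⟩
      ℚ.∣ recip a ℚ.- recip b ∣ ℚ.* ℚ.∣ a ℚ.* b ∣
        ≡⟨ sym (ℚ.∣p*q∣≡∣p∣*∣q∣ (recip a ℚ.- recip b) (a ℚ.* b)) ⟩
      ℚ.∣ (recip a ℚ.- recip b) ℚ.* (a ℚ.* b) ∣
        ≡⟨ cong ℚ.∣_∣ (regroup a b (recip a) (recip b)) ⟩
      ℚ.∣ (recip a ℚ.* a) ℚ.* b ℚ.- (recip b ℚ.* b) ℚ.* a ∣
        ≡⟨ cong₂ (λ p q → ℚ.∣ p ℚ.* b ℚ.- q ℚ.* a ∣) (recip-inverseˡ 0<a) (recip-inverseˡ 0<b) ⟩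
      ℚ.∣ 1ℚ ℚ.* b ℚ.- 1ℚ ℚ.* a ∣
        ≡⟨ cong₂ (λ p q → ℚ.∣ p ℚ.- q ∣) (ℚ.*-identityˡ b) (ℚ.*-identityˡ a) ⟩
      ℚ.∣ b ℚ.- a ∣
        ≤⟨ b-a ⟩
      ε ℚ.* (d ℚ.* d)
        ≤⟨ ℚ.*-monoˡ-≤-nonNeg ε {{ℚ.nonNegative (ℚ.<⇒≤ 0<ε)}}
             (*-mono-≤ (ℚ.<⇒≤ 0<d) (ℚ.<⇒≤ 0<b) d≤a d≤b) ⟩
      ε ℚ.* (a ℚ.* b) ∎)
      where
      0<a : 0ℚ ℚ.< a
      0<a = ℚ.<-≤-trans 0<d d≤a
      0<b : 0ℚ ℚ.< b
      0<b = ℚ.<-≤-trans 0<d d≤b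
      0<ab : 0ℚ ℚ.< a ℚ.* b
      0<ab = 0<* 0<a 0<b

infix 8 1/_⟨_⟩

1/_⟨_⟩ : (x : ℝ) → 0ℝ < x → ℝ
1/ x ⟨ 0<x ⟩ = mkℝ (λ n → recip (seq x n)) (recip-cauchy x 0<x)

sum : List ℝ → ℝ
sum = List.foldr _+_ 0ℝ

product : List ℝ → ℝ
product = List.foldr _*_ 1ℝ

-- The k-element subsets of the vertex set Fin n.
Hyperedge : ℕ → ℕ → Set
Hyperedge k n = Σ[ e ∈ Subset n ] ∣ e ∣ ≡ k

record Hypergraph (k : ℕ) : Set where
  field
    order    : ℕ
    edges    : List (Hyperedge k order)
    distinct : Unique edges

  Vertex : Set
  Vertex = Fin order

open Hypergraph public

elements : ∀ {n} (p : Subset n) → Vec (Fin n) ∣ p ∣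
elements []          = []
elements (true  ∷ p) = zero ∷ Vec.map suc (elements p)
elements (false ∷ p) = Vec.map suc (elements p)

-- Lists {v₁, …, vₖ} in increasing order; for symmetric f the order is
-- immaterial.
endpoints : ∀ {k n} → Hyperedge k n → Vec (Fin n) k
endpoints (e , ∣e∣≡k) = Vec.cast ∣e∣≡k (elements e)

Spin : Set
Spin = Fin 2

Config : ℕ → Set
Config n = Vec Spin n

configs : ∀ n → List (Config n)
configs zero    = [] ∷ []
configs (suc n) = List.cartesianProductWith _∷_ (List.allFin 2) (configs n)

module _ {k : ℕ} (f : Vec Spin k → ℝ) where

  Symmetric : Set
  Symmetric = ∀ (π : Permutation′ k) x →
    f (tabulate λ i → lookup x (π ⟨$⟩ʳ i)) ≃ f x

  module _ (H : Hypergraph k) where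

    weight : Config (order H) → ℝ
    weight σ = product (List.map (λ e → f (Vec.map (lookup σ) (endpoints e))) (edges H))

    Z : ℝ
    Z = sum (List.map weight (configs (order H)))

    module _ (Z>0 : 0ℝ < Z) where

      μ : Config (order H) → ℝ
      μ σ = weight σ * 1/ Z ⟨ Z>0 ⟩

      Pr : {A : Pred (Config (order H)) 0ℓ} → Decidable A → ℝ
      Pr A? = sum (List.map μ (List.filter A? (configs (order H))))

  SupportsPinning : Spin → Set
  SupportsPinning s = ∀ ε → 0ℝ < ε →
    Σ[ H ∈ Hypergraph k ] Σ[ v ∈ Vertex H ] Σ[ Z>0 ∈ 0ℝ < Z H ]
      Pr H Z>0 (λ σ → lookup σ v Fin.≟ s) ≥ 1ℝ - ε

  SupportsEquality : ℕ → Set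
  SupportsEquality t = ∀ ε → 0ℝ < ε →
    Σ[ H ∈ Hypergraph k ] Σ[ vs ∈ Vec (Vertex H) t ] Σ[ Z>0 ∈ 0ℝ < Z H ]
      Distinct.Unique vs ×
      (∀ s → Pr H Z>0 (λ σ → all? (λ v → lookup σ v Fin.≟ s) vs) ≥ (1ℝ - ε) * ½ℝ)

{-# OPTIONS --safe #-}

-- Tie the first ℓ vertices of a hyperedge to a vertex x and the remaining
-- k - ℓ to a vertex y by copies of the equality gadget.  Up to a common factor
-- and a small error, the weight of x = a, summed over the value of y, is
-- w(0) + w(k-ℓ) for a = 0 and w(ℓ) + w(k) for a = 1.  If these differed, gluing
-- many copies at x would amplify their ratio and pin x.  So
-- w(0) + w(k-ℓ) = w(ℓ) + w(k) for every ℓ; ℓ = k gives w(0) = w(k), and the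
-- claim follows.
--
-- All estimates are made in ℚ at one late index of the Cauchy sequences, after
-- replacing w by |w| so that the weights are non-negative termwise.
module Submission where

open import Defs
open CauchyLemmas
open import Data.Bool using (Bool; true; false; if_then_else_; _∧_)
open import Data.Fin using (Fin; zero; suc; toℕ; opposite; punchOut; _↑ˡ_)
import Data.Fin.Properties as Fin
open import Data.Fin.Subset using (Subset; ∣_∣)
open import Data.Integer as ℤ using (+_)
import Data.Integer.Solver as ℤ
open import Data.List as List using (List; []; _∷_)
open import Data.List.Membership.Propositional.Properties using (∈-map⁻)
import Data.List.Properties as List
open import Data.List.Relation.Unary.All as All using (All; []; _∷_)
import Data.List.Relation.Unary.All.Properties as All
open import Data.List.Relation.Unary.AllPairs using ([]; _∷_)
open import Data.List.Relation.Unary.Unique.Propositional using (Unique)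
import Data.List.Relation.Unary.Unique.Propositional.Properties as Unique
open import Data.Nat as ℕ using (ℕ; zero; suc)
open import Data.Nat.DivMod using (_mod_; m<n⇒m%n≡m; m%n<n)
import Data.Nat.Properties as ℕ
open import Data.Product using (∃-syntax; Σ-syntax; _×_; _,_; proj₁; proj₂)
open import Data.Rational as ℚ using (ℚ; 0ℚ; 1ℚ; ½)
import Data.Rational.Properties as ℚ
open import Data.Rational.Solver using (module +-*-Solver)
import Data.Rational.Unnormalised as ℚᵘ
import Data.Rational.Unnormalised.Properties as ℚᵘ
open import Data.Sum using (_⊎_; inj₁; inj₂)
open import Data.Vec as Vec using (Vec; []; _∷_; _++_; lookup; insertAt; removeAt; replicate)
import Data.Vec.Properties as Vec
open import Data.Vec.Relation.Unary.All as VecAll using (all?)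
import Data.Vec.Relation.Unary.AllPairs as VecAllPairs
import Data.Vec.Relation.Unary.Unique.Propositional as Distinct
open import Function using (_∘_; case_of_)
open import Level using (0ℓ)
open import Relation.Binary.PropositionalEquality
open import Relation.Nullary using (¬_; does; contradiction)
open import Relation.Unary using (Pred; Decidable)

-- Gluing hypergraphs

-- Hyperedges form a set, so copies must not overlap in an edge, and an edge contains a vertex only
-- once. That is why the vertices of the central hyperedge are all fresh, each tied to `x` or `y` by
-- a gadget of its own, and why gluing always identifies a single vertex: two glued parts share only
-- that vertex and, as `2 ≤ k`, no edge. The same separation makes weights factor: once the shared
-- spin is fixed the copies are independent, so the root weight of `M` copies is an `M`-th power.
--
-- The other constraint is the order of choices. Bounds on reals speak only of late indices, while
-- the hypergraph has to be chosen before any index. Hence the gadget's precision and the number of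
-- copies are computed from data free of the index: a bound on the weights, the number of gadgets,
-- the gap and the target accuracy. Equality of reals cannot be decided; it is derived by refuting a
-- uniform rational gap in either direction, and such a gap is exactly what amplification can
-- exploit.

bit : Bool → Spin → ℕ
bit true  s = toℕ s
bit false s = 0

bit-zero : ∀ b → bit b zero ≡ 0
bit-zero true  = refl
bit-zero false = refl

bit≤1 : ∀ b s → bit b s ℕ.≤ 1
bit≤1 true  s = ℕ.s≤s⁻¹ (Fin.toℕ<n s)
bit≤1 false s = ℕ.z≤n

-- For symmetric `f` an edge is weighed by its spin sum alone. Taking that sum over the subset
-- itself, not over a vector of endpoints, turns every gluing law into an identity of `dot`.
dot : ∀ {n} → Subset n → Config n → ℕ
dot []      []      = 0
dot (b ∷ e) (s ∷ σ) = bit b s ℕ.+ dot e σ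

count : ∀ {n} → Config n → ℕ
count σ = Vec.sum (Vec.map toℕ σ)

count≤ : ∀ {n} (σ : Config n) → count σ ℕ.≤ n
count≤ []      = ℕ.z≤n
count≤ (s ∷ σ) = ℕ.+-mono-≤ (ℕ.s≤s⁻¹ (Fin.toℕ<n s)) (count≤ σ)

count-endpoints : ∀ {k n} (e : Hyperedge k n) σ →
                  count (Vec.map (lookup σ) (endpoints e)) ≡ dot (proj₁ e) σ
count-endpoints (e , refl) σ =
  trans (cong (count ∘ Vec.map (lookup σ)) (Vec.cast-is-id refl (elements e))) (go e σ)
  where
  go : ∀ {n} (e : Subset n) σ → count (Vec.map (lookup σ) (elements e)) ≡ dot e σ
  shift : ∀ {n} (e : Subset n) s σ →
          count (Vec.map (lookup (s ∷ σ)) (Vec.map suc (elements e))) ≡ dot e σ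
  shift e s σ = trans (cong count (sym (Vec.map-∘ (lookup (s ∷ σ)) suc (elements e)))) (go e σ)
  go []          []      = refl
  go (true ∷ e)  (s ∷ σ) = cong (toℕ s ℕ.+_) (shift e s σ)
  go (false ∷ e) (s ∷ σ) = shift e s σ

dot-++ : ∀ {m n} (e : Subset m) (d : Subset n) σ τ → dot (e ++ d) (σ ++ τ) ≡ dot e σ ℕ.+ dot d τ
dot-++ []      d []      τ = refl
dot-++ (b ∷ e) d (s ∷ σ) τ =
  trans (cong (bit b s ℕ.+_) (dot-++ e d σ τ)) (sym (ℕ.+-assoc (bit b s) (dot e σ) (dot d τ)))

dot-∅ : ∀ {n} (σ : Config n) → dot (replicate n false) σ ≡ 0
dot-∅ []      = refl
dot-∅ (s ∷ σ) = dot-∅ σ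

dot-insertAt : ∀ {n} (e : Subset (suc n)) τ u s →
               dot e (insertAt τ u s) ≡ bit (lookup e u) s ℕ.+ dot (removeAt e u) τ
dot-insertAt (b ∷ e)     τ       zero    s = refl
dot-insertAt (b ∷ c ∷ e) (t ∷ τ) (suc u) s = begin
  bit b t ℕ.+ dot (c ∷ e) (insertAt τ u s) ≡⟨ cong (bit b t ℕ.+_) (dot-insertAt (c ∷ e) τ u s) ⟩
  bit b t ℕ.+ (B ℕ.+ D)                    ≡⟨ ℕ.+-comm (bit b t) (B ℕ.+ D) ⟩
  (B ℕ.+ D) ℕ.+ bit b t                    ≡⟨ ℕ.+-assoc B D (bit b t) ⟩
  B ℕ.+ (D ℕ.+ bit b t)                    ≡⟨ cong (B ℕ.+_) (ℕ.+-comm D (bit b t)) ⟩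
  B ℕ.+ (bit b t ℕ.+ D)                    ∎
  where
  open ≡-Reasoning
  B = bit (lookup (c ∷ e) u) s
  D = dot (removeAt (c ∷ e) u) τ

-- Either `{x}` or the empty set, according to `b`. With `b` the bit that tells whether an edge
-- contains `u`, this hands the membership over to `x` without a case split.
single : ∀ {n} → Fin n → Bool → Subset n
single {suc n} zero    b = b ∷ replicate n false
single         (suc x) b = false ∷ single x b

lookup-single : ∀ {n} (x : Fin n) b → lookup (single x b) x ≡ b
lookup-single zero    b = refl
lookup-single (suc x) b = lookup-single x b

dot-single : ∀ {n} (x : Fin n) b σ → dot (single x b) σ ≡ bit b (lookup σ x)
dot-single zero    b (s ∷ σ) = trans (cong (bit b s ℕ.+_) (dot-∅ σ)) (ℕ.+-identityʳ (bit b s))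
dot-single (suc x) b (s ∷ σ) = dot-single x b σ

ones : ∀ n → Config n
ones n = replicate n (suc zero)

-- Makes cardinality a special case of the spin sum, so that the sizes of glued edges follow from
-- the same identities as their weights.
dot-ones : ∀ {n} (e : Subset n) → dot e (ones n) ≡ ∣ e ∣
dot-ones []          = refl
dot-ones (true ∷ e)  = cong suc (dot-ones e)
dot-ones (false ∷ e) = dot-ones e

ones-++ : ∀ m n → ones m ++ ones n ≡ ones (m ℕ.+ n)
ones-++ zero    n = refl
ones-++ (suc m) n = cong (suc zero ∷_) (ones-++ m n)

insertAt-ones : ∀ n (u : Fin (suc n)) → insertAt (ones n) u (suc zero) ≡ ones (suc n)
insertAt-ones n       zero    = refl
insertAt-ones (suc n) (suc u) = cong (suc zero ∷_) (insertAt-ones n u)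

-- A subset read as a configuration: `dot e (indicator p)` is the size of the intersection of `e`
-- and `p`.
indicator : ∀ {n} → Subset n → Config n
indicator = Vec.map (λ b → if b then suc zero else zero)

dot-indicator : ∀ {n} (p : Subset n) → dot p (indicator p) ≡ ∣ p ∣
dot-indicator []          = refl
dot-indicator (true ∷ p)  = cong suc (dot-indicator p)
dot-indicator (false ∷ p) = dot-indicator p

dot-indicator-single : ∀ {n} (e : Subset n) v → dot e (indicator (single v true)) ℕ.≤ 1
dot-indicator-single (b ∷ e) zero    = subst (ℕ._≤ 1)
  (sym (trans (cong (bit b (suc zero) ℕ.+_) (dot-indicator-∅ e)) (ℕ.+-identityʳ _)))
  (bit≤1 b (suc zero))
  where
  dot-indicator-∅ : ∀ {n} (e : Subset n) → dot e (indicator (replicate n false)) ≡ 0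
  dot-indicator-∅ []      = refl
  dot-indicator-∅ (b ∷ e) = cong₂ ℕ._+_ (bit-zero b) (dot-indicator-∅ e)
dot-indicator-single (b ∷ e) (suc v) = subst (ℕ._≤ 1)
  (sym (cong (ℕ._+ dot e (indicator (single v true))) (bit-zero b))) (dot-indicator-single e v)

hyperedge-≡ : ∀ {k n} {e d : Hyperedge k n} → proj₁ e ≡ proj₁ d → e ≡ d
hyperedge-≡ {e = e , p} {.e , q} refl = cong (e ,_) (ℕ.≡-irrelevant p q)

-- The vertex u of the second hypergraph is identified with the vertex x of the
-- first; its other vertices follow those of the first.
module Glue {k n m : ℕ} (x : Fin n) (u : Fin (suc m)) where

  left : Subset n → Subset (n ℕ.+ m)
  left e = e ++ replicate m false

  right : Subset (suc m) → Subset (n ℕ.+ m)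
  right e = single x (lookup e u) ++ removeAt e u

  dot-left : ∀ e σ τ → dot (left e) (σ ++ τ) ≡ dot e σ
  dot-left e σ τ = trans (dot-++ e (replicate m false) σ τ)
    (trans (cong (dot e σ ℕ.+_) (dot-∅ τ)) (ℕ.+-identityʳ (dot e σ)))

  dot-right : ∀ e σ τ → dot (right e) (σ ++ τ) ≡ dot e (insertAt τ u (lookup σ x))
  dot-right e σ τ = trans (dot-++ (single x (lookup e u)) (removeAt e u) σ τ)
    (trans (cong (ℕ._+ dot (removeAt e u) τ) (dot-single x (lookup e u) σ))
           (sym (dot-insertAt e τ u (lookup σ x))))

  ∣left∣ : ∀ e → ∣ left e ∣ ≡ ∣ e ∣
  ∣left∣ e = begin
    ∣ left e ∣                        ≡⟨ sym (dot-ones (left e)) ⟩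
    dot (left e) (ones (n ℕ.+ m))     ≡⟨ cong (dot (left e)) (sym (ones-++ n m)) ⟩
    dot (left e) (ones n ++ ones m)   ≡⟨ dot-left e (ones n) (ones m) ⟩
    dot e (ones n)                    ≡⟨ dot-ones e ⟩
    ∣ e ∣                             ∎
    where open ≡-Reasoning

  ∣right∣ : ∀ e → ∣ right e ∣ ≡ ∣ e ∣
  ∣right∣ e = begin
    ∣ right e ∣                                    ≡⟨ sym (dot-ones (right e)) ⟩
    dot (right e) (ones (n ℕ.+ m))                 ≡⟨ cong (dot (right e)) (sym (ones-++ n m)) ⟩
    dot (right e) (ones n ++ ones m)               ≡⟨ dot-right e (ones n) (ones m) ⟩
    dot e (insertAt (ones m) u (lookup (ones n) x))
      ≡⟨ cong (dot e ∘ insertAt (ones m) u) (Vec.lookup-replicate x (suc zero)) ⟩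
    dot e (insertAt (ones m) u (suc zero))         ≡⟨ cong (dot e) (insertAt-ones m u) ⟩
    dot e (ones (suc m))                           ≡⟨ dot-ones e ⟩
    ∣ e ∣                                          ∎
    where open ≡-Reasoning

  leftᴱ : Hyperedge k n → Hyperedge k (n ℕ.+ m)
  leftᴱ (e , p) = left e , trans (∣left∣ e) p

  rightᴱ : Hyperedge k (suc m) → Hyperedge k (n ℕ.+ m)
  rightᴱ (e , p) = right e , trans (∣right∣ e) p

  glue : List (Hyperedge k n) → List (Hyperedge k (suc m)) → List (Hyperedge k (n ℕ.+ m))
  glue es ds = List.map leftᴱ es List.++ List.map rightᴱ ds

  leftᴱ-injective : ∀ {e d} → leftᴱ e ≡ leftᴱ d → e ≡ d
  leftᴱ-injective {e , _} {d , _} eq = hyperedge-≡ (Vec.++-injectiveˡ e d (cong proj₁ eq))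

  rightᴱ-injective : ∀ {e d} → rightᴱ e ≡ rightᴱ d → e ≡ d
  rightᴱ-injective {e , _} {d , _} eq = hyperedge-≡ (begin
    e                                      ≡⟨ sym (Vec.insertAt-removeAt e u) ⟩
    insertAt (removeAt e u) u (lookup e u) ≡⟨ cong₂ (λ r b → insertAt r u b) tails heads ⟩
    insertAt (removeAt d u) u (lookup d u) ≡⟨ Vec.insertAt-removeAt d u ⟩
    d                                      ∎)
    where
    open ≡-Reasoning
    parts = Vec.++-injective (single x (lookup e u)) (single x (lookup d u)) (cong proj₁ eq)
    tails = proj₂ parts
    heads : lookup e u ≡ lookup d u
    heads = trans (sym (lookup-single x (lookup e u)))
      (trans (cong (λ p → lookup p x) (proj₁ parts)) (lookup-single x (lookup d u)))

  -- A common edge would be contained in {x}.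
  leftᴱ≢rightᴱ : 2 ℕ.≤ k → ∀ e d → leftᴱ e ≢ rightᴱ d
  leftᴱ≢rightᴱ 2≤k (e , ∣e∣≡k) (d , _) eq = ℕ.<⇒≱ 2≤k (begin
    k                                              ≡⟨ sym ∣e∣≡k ⟩
    ∣ e ∣                                          ≡⟨ sym (dot-ones e) ⟩
    dot e (ones n)
      ≡⟨ cong (λ p → dot p (ones n)) (Vec.++-injectiveˡ e (single x (lookup d u)) (cong proj₁ eq)) ⟩
    dot (single x (lookup d u)) (ones n)           ≡⟨ dot-single x (lookup d u) (ones n) ⟩
    bit (lookup d u) (lookup (ones n) x)           ≤⟨ bit≤1 (lookup d u) (lookup (ones n) x) ⟩
    1                                              ∎)
    where open ℕ.≤-Reasoning

  glue-unique : 2 ℕ.≤ k → ∀ {es ds} → Unique es → Unique ds → Unique (glue es ds)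
  glue-unique 2≤k ues uds = Unique.++⁺ (Unique.map⁺ leftᴱ-injective ues)
    (Unique.map⁺ rightᴱ-injective uds)
    λ (l , r) → case ∈-map⁻ leftᴱ l , ∈-map⁻ rightᴱ r of
      λ { ((e , _ , p) , (d , _ , q)) → leftᴱ≢rightᴱ 2≤k e d (trans (sym p) q) }

open Glue using (glue; glue-unique) public

-- Two vertices 0 and 1, and for each t in the list a copy of the gadget ds
-- whose vertex u is identified with t; the leaves are the copies of its
-- other distinguished vertex.
module Star {k m : ℕ} (ds : List (Hyperedge k (suc m))) (u : Fin (suc m)) (v : Fin m) where

  size : List (Fin 2) → ℕ
  size []       = 0
  size (t ∷ ts) = size ts ℕ.+ m

  star : ∀ ts → List (Hyperedge k (2 ℕ.+ size ts))
  star []       = []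
  star (t ∷ ts) = glue (t ↑ˡ size ts) u (star ts) ds

  leaves : ∀ ts → Subset (size ts)
  leaves []       = []
  leaves (t ∷ ts) = leaves ts ++ single v true

  ∣leaves∣ : ∀ ts → ∣ leaves ts ∣ ≡ List.length ts
  ∣leaves∣ []       = refl
  ∣leaves∣ (t ∷ ts) = begin
    ∣ leaves ts ++ single v true ∣                    ≡⟨ sym (dot-ones (leaves (t ∷ ts))) ⟩
    dot (leaves (t ∷ ts)) (ones (size ts ℕ.+ m))
      ≡⟨ cong (dot (leaves (t ∷ ts))) (sym (ones-++ (size ts) m)) ⟩
    dot (leaves (t ∷ ts)) (ones (size ts) ++ ones m)
      ≡⟨ dot-++ (leaves ts) (single v true) (ones (size ts)) (ones m) ⟩
    dot (leaves ts) (ones (size ts)) ℕ.+ dot (single v true) (ones m)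
      ≡⟨ cong₂ ℕ._+_ (trans (dot-ones (leaves ts)) (∣leaves∣ ts)) (trans (dot-single v true (ones m))
          (cong toℕ (Vec.lookup-replicate v (suc zero)))) ⟩
    List.length ts ℕ.+ 1                              ≡⟨ ℕ.+-comm (List.length ts) 1 ⟩
    suc (List.length ts)                              ∎
    where open ≡-Reasoning

  leaves⁺ : ∀ ts → Subset (2 ℕ.+ size ts)
  leaves⁺ ts = false ∷ false ∷ leaves ts

  -- Each edge of the star lies in one gadget copy, and each copy contains one leaf. This separates
  -- the star from the edge formed by all the leaves.
  star-meets-leaves : ∀ ts → All (λ e → dot (proj₁ e) (indicator (leaves⁺ ts)) ℕ.≤ 1) (star ts)
  star-meets-leaves []       = []
  star-meets-leaves (t ∷ ts) = All.++⁺
    (All.map⁺ (All.map (λ {e} → old e) (star-meets-leaves ts)))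
    (All.map⁺ (All.universal new ds))
    where
    module G = Glue {k} (t ↑ˡ size ts) u
    -- The vertices 0 and 1 are not leaves, so the vertex `u` of the new copy adds nothing to the
    -- intersection.
    root≡0 : lookup (indicator (leaves⁺ ts)) (t ↑ˡ size ts) ≡ zero
    root≡0 = trans (Vec.lookup-++ˡ (zero ∷ zero ∷ []) (indicator (leaves ts)) t) (at t)
      where
      at : ∀ t → lookup (zero {1} ∷ zero ∷ []) t ≡ zero
      at zero       = refl
      at (suc zero) = refl
    split : indicator (leaves⁺ (t ∷ ts)) ≡ indicator (leaves⁺ ts) ++ indicator (single v true)
    split = Vec.map-++ _ (leaves⁺ ts) (single v true)
    old : ∀ e → dot (proj₁ e) (indicator (leaves⁺ ts)) ℕ.≤ 1 →
          dot (G.left (proj₁ e)) (indicator (leaves⁺ (t ∷ ts))) ℕ.≤ 1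
    old (e , _) = subst (ℕ._≤ 1) (sym (trans (cong (dot (G.left e)) split)
      (G.dot-left e (indicator (leaves⁺ ts)) (indicator (single v true)))))
    new : ∀ e → dot (G.right (proj₁ e)) (indicator (leaves⁺ (t ∷ ts))) ℕ.≤ 1
    new (e , _) = subst (ℕ._≤ 1) (sym (begin
      dot (G.right e) (indicator (leaves⁺ (t ∷ ts)))
        ≡⟨ cong (dot (G.right e)) split ⟩
      dot (G.right e) (indicator (leaves⁺ ts) ++ indicator (single v true))
        ≡⟨ G.dot-right e (indicator (leaves⁺ ts)) (indicator (single v true)) ⟩
      dot e (insertAt (indicator (single v true)) u (lookup (indicator (leaves⁺ ts)) (t ↑ˡ size ts)))
        ≡⟨ cong (dot e ∘ insertAt (indicator (single v true)) u) root≡0 ⟩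
      dot e (insertAt (indicator (single v true)) u zero)
        ≡⟨ dot-insertAt e (indicator (single v true)) u zero ⟩
      bit (lookup e u) zero ℕ.+ dot (removeAt e u) (indicator (single v true))
        ≡⟨ cong (ℕ._+ dot (removeAt e u) (indicator (single v true))) (bit-zero (lookup e u)) ⟩
      dot (removeAt e u) (indicator (single v true)) ∎))
      (dot-indicator-single (removeAt e u) v)
      where open ≡-Reasoning

  closed : ∀ ts → List.length ts ≡ k → List (Hyperedge k (2 ℕ.+ size ts))
  closed ts eq = (leaves⁺ ts , trans (∣leaves∣ ts) eq) ∷ star ts

  star-unique : 2 ℕ.≤ k → Unique ds → ∀ ts → Unique (star ts)
  star-unique 2≤k uds []       = []
  star-unique 2≤k uds (t ∷ ts) = glue-unique (t ↑ˡ size ts) u 2≤k (star-unique 2≤k uds ts) uds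

  -- The leaf edge meets the leaf set in `k ≥ 2` vertices, an edge of the star in at most one.
  closed-unique : 2 ℕ.≤ k → Unique ds → ∀ ts eq → Unique (closed ts eq)
  closed-unique 2≤k uds ts eq = All.map (λ {e} → fresh e) (star-meets-leaves ts) ∷ star-unique 2≤k uds ts
    where
    fresh : ∀ e → dot (proj₁ e) (indicator (leaves⁺ ts)) ℕ.≤ 1 → (leaves⁺ ts , trans (∣leaves∣ ts) eq) ≢ e
    fresh _ ≤1 refl = ℕ.<⇒≱ 2≤k (subst (ℕ._≤ 1)
      (trans (dot-indicator (leaves⁺ ts)) (trans (∣leaves∣ ts) eq)) ≤1)

-- The amplifier: copies that share only their vertex 0 are independent once its spin is fixed.
module Bouquet {k m : ℕ} (ds : List (Hyperedge k (suc m))) where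

  size : ℕ → ℕ
  size zero    = 0
  size (suc M) = size M ℕ.+ m

  bouquet : ∀ M → List (Hyperedge k (suc (size M)))
  bouquet zero    = []
  bouquet (suc M) = glue zero zero (bouquet M) ds

  bouquet-unique : 2 ℕ.≤ k → Unique ds → ∀ M → Unique (bouquet M)
  bouquet-unique 2≤k uds zero    = []
  bouquet-unique 2≤k uds (suc M) = glue-unique zero zero 2≤k (bouquet-unique 2≤k uds M) uds

-- Partition functions of glued hypergraphs over ℚ

2ℚ : ℚ
2ℚ = 1ℚ ℚ.+ 1ℚ

0≤1 : 0ℚ ℚ.≤ 1ℚ
0≤1 = ℚ.nonNegative⁻¹ 1ℚ

0≤+ : ∀ {p q} → 0ℚ ℚ.≤ p → 0ℚ ℚ.≤ q → 0ℚ ℚ.≤ p ℚ.+ q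
0≤+ {p} {q} 0≤p 0≤q = ℚ.+-mono-≤ {0ℚ} {p} {0ℚ} {q} 0≤p 0≤q

0≤* : ∀ {p q} → 0ℚ ℚ.≤ p → 0ℚ ℚ.≤ q → 0ℚ ℚ.≤ p ℚ.* q
0≤* {p} {q} 0≤p 0≤q = ℚ.nonNegative⁻¹ (p ℚ.* q)
  {{ℚ.nonNeg*nonNeg⇒nonNeg p {{ℚ.nonNegative 0≤p}} q {{ℚ.nonNegative 0≤q}}}}

≤-by : ∀ {p q} r → 0ℚ ℚ.≤ r → q ≡ p ℚ.+ r → p ℚ.≤ q
≤-by {p} {q} r 0≤r eq = begin
  p          ≡⟨ sym (ℚ.+-identityʳ p) ⟩
  p ℚ.+ 0ℚ   ≤⟨ ℚ.+-monoʳ-≤ p 0≤r ⟩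
  p ℚ.+ r    ≡⟨ sym eq ⟩
  q          ∎
  where open ℚ.≤-Reasoning

p≤p+q : ∀ {p q} → 0ℚ ℚ.≤ q → p ℚ.≤ p ℚ.+ q
p≤p+q {p} {q} 0≤q = ≤-by q 0≤q refl

q≤p+q : ∀ {p q} → 0ℚ ℚ.≤ p → q ℚ.≤ p ℚ.+ q
q≤p+q {p} {q} 0≤p = ≤-by p 0≤p (ℚ.+-comm p q)

0≤- : ∀ {p q} → p ℚ.≤ q → 0ℚ ℚ.≤ q ℚ.- p
0≤- {p} {q} p≤q = subst (ℚ._≤ q ℚ.- p) (ℚ.+-inverseʳ p) (ℚ.+-monoˡ-≤ (ℚ.- p) p≤q)

*-monoˡ : ∀ {p q r} → 0ℚ ℚ.≤ r → p ℚ.≤ q → r ℚ.* p ℚ.≤ r ℚ.* q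
*-monoˡ {r = r} 0≤r = ℚ.*-monoˡ-≤-nonNeg r {{ℚ.nonNegative 0≤r}}

*-monoʳ : ∀ {p q r} → 0ℚ ℚ.≤ r → p ℚ.≤ q → p ℚ.* r ℚ.≤ q ℚ.* r
*-monoʳ {r = r} 0≤r = ℚ.*-monoʳ-≤-nonNeg r {{ℚ.nonNegative 0≤r}}

infixr 8 _^_

_^_ : ℚ → ℕ → ℚ
q ^ zero  = 1ℚ
q ^ suc n = q ℚ.* q ^ n

0≤^ : ∀ {q} → 0ℚ ℚ.≤ q → ∀ n → 0ℚ ℚ.≤ q ^ n
0≤^ 0≤q zero    = 0≤1
0≤^ 0≤q (suc n) = 0≤* 0≤q (0≤^ 0≤q n)

0<^ : ∀ {q} → 0ℚ ℚ.< q → ∀ n → 0ℚ ℚ.< q ^ n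
0<^ 0<q zero    = ℚ.positive⁻¹ 1ℚ
0<^ 0<q (suc n) = 0<* 0<q (0<^ 0<q n)

^-mono : ∀ {p q} → 0ℚ ℚ.≤ p → p ℚ.≤ q → ∀ n → p ^ n ℚ.≤ q ^ n
^-mono 0≤p p≤q zero    = ℚ.≤-refl
^-mono 0≤p p≤q (suc n) =
  *-mono-≤ 0≤p (0≤^ (ℚ.≤-trans 0≤p p≤q) n) p≤q (^-mono 0≤p p≤q n)

_·_ : ℕ → ℚ → ℚ
zero  · q = 0ℚ
suc n · q = q ℚ.+ n · q

0≤· : ∀ {q} → 0ℚ ℚ.≤ q → ∀ n → 0ℚ ℚ.≤ n · q
0≤· 0≤q zero    = ℚ.≤-refl
0≤· 0≤q (suc n) = 0≤+ 0≤q (0≤· 0≤q n)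

-- Bernoulli's inequality for the ratio x / y, multiplied out.
bernoulli : ∀ {x y θ} → 0ℚ ℚ.≤ y → 0ℚ ℚ.≤ θ → (1ℚ ℚ.+ θ) ℚ.* y ℚ.≤ x →
            ∀ n → (1ℚ ℚ.+ n · θ) ℚ.* y ^ n ℚ.≤ x ^ n
bernoulli 0≤y 0≤θ h zero    = ℚ.≤-refl
bernoulli {x} {y} {θ} 0≤y 0≤θ h (suc n) = begin
  (1ℚ ℚ.+ (θ ℚ.+ n · θ)) ℚ.* (y ℚ.* y ^ n)
    ≤⟨ ≤-by (θ ℚ.* n · θ ℚ.* (y ℚ.* y ^ n)) (0≤* (0≤* 0≤θ (0≤· 0≤θ n)) (0≤* 0≤y (0≤^ 0≤y n)))
            (expand θ (n · θ) y (y ^ n)) ⟩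
  ((1ℚ ℚ.+ θ) ℚ.* y) ℚ.* ((1ℚ ℚ.+ n · θ) ℚ.* y ^ n)
    ≤⟨ *-mono-≤ (0≤* (0≤+ 0≤1 0≤θ) 0≤y) (0≤^ 0≤x n) h (bernoulli 0≤y 0≤θ h n) ⟩
  x ℚ.* x ^ n ∎
  where
  open ℚ.≤-Reasoning
  open +-*-Solver
  0≤x : 0ℚ ℚ.≤ x
  0≤x = ℚ.≤-trans (0≤* (0≤+ 0≤1 0≤θ) 0≤y) h
  expand : ∀ a b y z → ((1ℚ ℚ.+ a) ℚ.* y) ℚ.* ((1ℚ ℚ.+ b) ℚ.* z) ≡
           (1ℚ ℚ.+ (a ℚ.+ b)) ℚ.* (y ℚ.* z) ℚ.+ a ℚ.* b ℚ.* (y ℚ.* z)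
  expand = solve 4 (λ a b y z → ((con 1ℚ :+ a) :* y) :* ((con 1ℚ :+ b) :* z) :=
           (con 1ℚ :+ (a :+ b)) :* (y :* z) :+ a :* b :* (y :* z)) refl

-- Sums over configurations, by recursion on the number of vertices

∑ : ∀ n → (Config n → ℚ) → ℚ
∑ zero    g = g []
∑ (suc n) g = ∑ n (g ∘ (zero ∷_)) ℚ.+ ∑ n (g ∘ (suc zero ∷_))

∑-cong : ∀ n {g h : Config n → ℚ} → (∀ σ → g σ ≡ h σ) → ∑ n g ≡ ∑ n h
∑-cong zero    g≡h = g≡h []
∑-cong (suc n) g≡h = cong₂ ℚ._+_ (∑-cong n (g≡h ∘ (zero ∷_))) (∑-cong n (g≡h ∘ (suc zero ∷_)))

∑-nonneg : ∀ n {g : Config n → ℚ} → (∀ σ → 0ℚ ℚ.≤ g σ) → 0ℚ ℚ.≤ ∑ n g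
∑-nonneg zero    0≤g = 0≤g []
∑-nonneg (suc n) 0≤g = 0≤+ (∑-nonneg n (0≤g ∘ (zero ∷_))) (∑-nonneg n (0≤g ∘ (suc zero ∷_)))

∑-0 : ∀ n → ∑ n (λ _ → 0ℚ) ≡ 0ℚ
∑-0 zero    = refl
∑-0 (suc n) = cong₂ ℚ._+_ (∑-0 n) (∑-0 n)

interchange : ∀ a b c d → (a ℚ.+ b) ℚ.+ (c ℚ.+ d) ≡ (a ℚ.+ c) ℚ.+ (b ℚ.+ d)
interchange = solve 4 (λ a b c d → (a :+ b) :+ (c :+ d) := (a :+ c) :+ (b :+ d)) refl
  where open +-*-Solver

∑-+ : ∀ n (g h : Config n → ℚ) → ∑ n (λ σ → g σ ℚ.+ h σ) ≡ ∑ n g ℚ.+ ∑ n h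
∑-+ zero    g h = refl
∑-+ (suc n) g h = trans
  (cong₂ ℚ._+_ (∑-+ n (g ∘ (zero ∷_)) (h ∘ (zero ∷_))) (∑-+ n (g ∘ (suc zero ∷_)) (h ∘ (suc zero ∷_))))
  (interchange (∑ n (g ∘ (zero ∷_))) _ _ _)

∑-*ˡ : ∀ n c (g : Config n → ℚ) → ∑ n (λ σ → c ℚ.* g σ) ≡ c ℚ.* ∑ n g
∑-*ˡ zero    c g = refl
∑-*ˡ (suc n) c g = trans
  (cong₂ ℚ._+_ (∑-*ˡ n c (g ∘ (zero ∷_))) (∑-*ˡ n c (g ∘ (suc zero ∷_))))
  (sym (ℚ.*-distribˡ-+ c (∑ n (g ∘ (zero ∷_))) (∑ n (g ∘ (suc zero ∷_)))))

∑-*ʳ : ∀ n c (g : Config n → ℚ) → ∑ n (λ σ → g σ ℚ.* c) ≡ ∑ n g ℚ.* c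
∑-*ʳ n c g = trans (∑-cong n (λ σ → ℚ.*-comm (g σ) c)) (trans (∑-*ˡ n c g) (ℚ.*-comm c (∑ n g)))

∑-++ : ∀ m n (g : Config (m ℕ.+ n) → ℚ) → ∑ (m ℕ.+ n) g ≡ ∑ m (λ σ → ∑ n (λ τ → g (σ ++ τ)))
∑-++ zero    n g = refl
∑-++ (suc m) n g = cong₂ ℚ._+_ (∑-++ m n (g ∘ (zero ∷_))) (∑-++ m n (g ∘ (suc zero ∷_)))

∑-insertAt : ∀ n (u : Fin (suc n)) (g : Config (suc n) → ℚ) → ∑ (suc n) g ≡
             ∑ n (λ τ → g (insertAt τ u zero)) ℚ.+ ∑ n (λ τ → g (insertAt τ u (suc zero)))
∑-insertAt n       zero    g = refl
∑-insertAt (suc n) (suc u) g = trans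
  (cong₂ ℚ._+_ (∑-insertAt n u (g ∘ (zero ∷_))) (∑-insertAt n u (g ∘ (suc zero ∷_))))
  (interchange (∑ n (λ τ → g (zero ∷ insertAt τ u zero))) _ _ _)

-- The spin sum of the leaves when every gadget copies its root's spin exactly.
level : Config 2 → List (Fin 2) → ℕ
level ab []       = 0
level ab (t ∷ ts) = level ab ts ℕ.+ toℕ (lookup ab t)

-- The limit, up to a common factor, of the weight of the closed star with
-- its vertex 0 set to a, as the gadget tends to exact equality.
bias : (ℕ → ℚ) → List (Fin 2) → Spin → ℚ
bias ω ts a = ω (level (a ∷ zero ∷ []) ts) ℚ.+ ω (level (a ∷ suc zero ∷ []) ts)

-- Each transfer through a gadget adds an error of 2κW and at most doubles the
-- bound W.
slack : ℕ → ℚ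
slack zero    = 0ℚ
slack (suc n) = 2ℚ ℚ.+ 2ℚ ℚ.* slack n

module Partition (ω : ℕ → ℚ) (0≤ω : ∀ c → 0ℚ ℚ.≤ ω c) where

  wt : ∀ {k n} → List (Hyperedge k n) → Config n → ℚ
  wt []       σ = 1ℚ
  wt (e ∷ es) σ = ω (dot (proj₁ e) σ) ℚ.* wt es σ

  0≤wt : ∀ {k n} (es : List (Hyperedge k n)) σ → 0ℚ ℚ.≤ wt es σ
  0≤wt []       σ = 0≤1
  0≤wt (e ∷ es) σ = 0≤* (0≤ω (dot (proj₁ e) σ)) (0≤wt es σ)

  -- Every glued edge comes from one side, and the edges of the second side read the spin of `u` off
  -- `x`; hence a product.
  wt-glue : ∀ {k n m} x u (es : List (Hyperedge k n)) (ds : List (Hyperedge k (suc m))) σ τ →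
            wt (glue x u es ds) (σ ++ τ) ≡ wt es σ ℚ.* wt ds (insertAt τ u (lookup σ x))
  wt-glue {k} x u [] ds σ τ = trans (go ds) (sym (ℚ.*-identityˡ (wt ds (insertAt τ u (lookup σ x)))))
    where
    go : ∀ ds → wt {k} (glue x u [] ds) (σ ++ τ) ≡ wt ds (insertAt τ u (lookup σ x))
    go []       = refl
    go (d ∷ ds) = cong₂ ℚ._*_ (cong ω (Glue.dot-right {k} x u (proj₁ d) σ τ)) (go ds)
  wt-glue {k} x u (e ∷ es) ds σ τ = trans
    (cong₂ ℚ._*_ (cong ω (Glue.dot-left {k} x u (proj₁ e) σ τ)) (wt-glue x u es ds σ τ))
    (sym (ℚ.*-assoc (ω (dot (proj₁ e) σ)) (wt es σ) _))

  -- The unnormalised marginal of the vertex `u`.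
  rooted : ∀ {k m} → List (Hyperedge k (suc m)) → Fin (suc m) → Spin → ℚ
  rooted {m = m} ds u s = ∑ m (λ τ → wt ds (insertAt τ u s))

  0≤rooted : ∀ {k m} (ds : List (Hyperedge k (suc m))) u s → 0ℚ ℚ.≤ rooted ds u s
  0≤rooted ds u s = ∑-nonneg _ (λ τ → 0≤wt ds (insertAt τ u s))

  rooted-bouquet : ∀ {k m} (ds : List (Hyperedge k (suc m))) M s →
                   rooted (Bouquet.bouquet ds M) zero s ≡ rooted ds zero s ^ M
  rooted-bouquet ds zero    s = refl
  rooted-bouquet {m = m} ds (suc M) s = begin
    ∑ (size M ℕ.+ m) (λ τ → wt (bouquet (suc M)) (s ∷ τ))
      ≡⟨ ∑-++ (size M) m (λ τ → wt (bouquet (suc M)) (s ∷ τ)) ⟩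
    ∑ (size M) (λ σ → ∑ m (λ τ → wt (bouquet (suc M)) (s ∷ (σ ++ τ))))
      ≡⟨ ∑-cong (size M) (λ σ → ∑-cong m (λ τ → wt-glue zero zero (bouquet M) ds (s ∷ σ) τ)) ⟩
    ∑ (size M) (λ σ → ∑ m (λ τ → wt (bouquet M) (s ∷ σ) ℚ.* wt ds (s ∷ τ)))
      ≡⟨ ∑-cong (size M) (λ σ → ∑-*ˡ m (wt (bouquet M) (s ∷ σ)) (λ τ → wt ds (s ∷ τ))) ⟩
    ∑ (size M) (λ σ → wt (bouquet M) (s ∷ σ) ℚ.* rooted ds zero s)
      ≡⟨ ∑-*ʳ (size M) (rooted ds zero s) (λ σ → wt (bouquet M) (s ∷ σ)) ⟩
    rooted (bouquet M) zero s ℚ.* rooted ds zero s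
      ≡⟨ cong (ℚ._* rooted ds zero s) (rooted-bouquet ds M s) ⟩
    rooted ds zero s ^ M ℚ.* rooted ds zero s
      ≡⟨ ℚ.*-comm (rooted ds zero s ^ M) (rooted ds zero s) ⟩
    rooted ds zero s ^ suc M ∎
    where
    open ≡-Reasoning
    open Bouquet ds

  -- Transfer of spins through an equality gadget

  module Gadget {k m : ℕ} (ds : List (Hyperedge k (suc m))) (u : Fin (suc m)) (v : Fin m) where

    open Star ds u v

    -- The unnormalised joint marginal of the two distinguished vertices, where `v` is numbered
    -- among the vertices other than `u`.
    pair : Spin → Spin → ℚ
    pair a b = ∑ m (λ τ → if does (lookup τ v Fin.≟ b) then wt ds (insertAt τ u a) else 0ℚ)

    0≤pair : ∀ a b → 0ℚ ℚ.≤ pair a b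
    0≤pair a b = ∑-nonneg m nonneg
      where
      nonneg : ∀ τ → 0ℚ ℚ.≤ (if does (lookup τ v Fin.≟ b) then wt ds (insertAt τ u a) else 0ℚ)
      nonneg τ with does (lookup τ v Fin.≟ b)
      ... | true  = 0≤wt ds (insertAt τ u a)
      ... | false = ℚ.≤-refl

    total : ℚ
    total = ∑ (suc m) (wt ds)

    total-split : total ≡ (pair zero zero ℚ.+ pair zero (suc zero)) ℚ.+
                          (pair (suc zero) zero ℚ.+ pair (suc zero) (suc zero))
    total-split = trans (∑-insertAt m u (wt ds)) (cong₂ ℚ._+_ (row zero) (row (suc zero)))
      where
      row : ∀ a → rooted ds u a ≡ pair a zero ℚ.+ pair a (suc zero)
      row a = trans (∑-cong m split) (∑-+ m _ _)
        where
        split : ∀ τ → wt ds (insertAt τ u a) ≡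
          (if does (lookup τ v Fin.≟ zero) then wt ds (insertAt τ u a) else 0ℚ) ℚ.+
          (if does (lookup τ v Fin.≟ suc zero) then wt ds (insertAt τ u a) else 0ℚ)
        split τ with lookup τ v
        ... | zero     = sym (ℚ.+-identityʳ _)
        ... | suc zero = sym (ℚ.+-identityˡ _)

    -- A row of a 2 × 2 transfer matrix: one gadget with root spin `s` is summed out. Here `g`
    -- weighs the spin sum of all leaves and `c` is the part contributed by the other leaves.
    transfer : Spin → (ℕ → ℚ) → ℕ → ℚ
    transfer s g c = ∑ m (λ τ → wt ds (insertAt τ u s) ℚ.* g (c ℕ.+ toℕ (lookup τ v)))

    transfer-pair : ∀ s g c → transfer s g c ≡
                    pair s zero ℚ.* g (c ℕ.+ 0) ℚ.+ pair s (suc zero) ℚ.* g (c ℕ.+ 1)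
    transfer-pair s g c = trans (∑-cong m split) (trans (∑-+ m _ _)
      (cong₂ ℚ._+_ (∑-*ʳ m (g (c ℕ.+ 0)) _) (∑-*ʳ m (g (c ℕ.+ 1)) _)))
      where
      split : ∀ τ → wt ds (insertAt τ u s) ℚ.* g (c ℕ.+ toℕ (lookup τ v)) ≡
        (if does (lookup τ v Fin.≟ zero) then wt ds (insertAt τ u s) else 0ℚ) ℚ.* g (c ℕ.+ 0) ℚ.+
        (if does (lookup τ v Fin.≟ suc zero) then wt ds (insertAt τ u s) else 0ℚ) ℚ.* g (c ℕ.+ 1)
      split τ with lookup τ v
      ... | zero     = sym (trans (cong (W ℚ.* g (c ℕ.+ 0) ℚ.+_) (ℚ.*-zeroˡ (g (c ℕ.+ 1))))
                                  (ℚ.+-identityʳ (W ℚ.* g (c ℕ.+ 0))))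
        where W = wt ds (insertAt τ u s)
      ... | suc zero = sym (trans (cong (ℚ._+ W ℚ.* g (c ℕ.+ 1)) (ℚ.*-zeroˡ (g (c ℕ.+ 0))))
                                  (ℚ.+-identityˡ (W ℚ.* g (c ℕ.+ 1))))
        where W = wt ds (insertAt τ u s)

    transfers : List (Fin 2) → Config 2 → (ℕ → ℚ) → ℕ → ℚ
    transfers []       ab g = g
    transfers (t ∷ ts) ab g = transfers ts ab (transfer (lookup ab t) g)

    -- The function `g` is arbitrary because the induction sums out the newest gadget and so
    -- replaces `g` by its transfer; the intended `g` is `ω`, the weight of the leaf edge.
    ∑-star : ∀ ts a b g →
             ∑ (size ts) (λ τ → wt (star ts) (a ∷ b ∷ τ) ℚ.* g (dot (leaves ts) τ)) ≡
             transfers ts (a ∷ b ∷ []) g 0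
    ∑-star []       a b g = ℚ.*-identityˡ (g 0)
    ∑-star (t ∷ ts) a b g = begin
      ∑ (size ts ℕ.+ m) (λ τ → wt (star (t ∷ ts)) (a ∷ b ∷ τ) ℚ.* g (dot (leaves (t ∷ ts)) τ))
        ≡⟨ ∑-++ (size ts) m _ ⟩
      ∑ (size ts) (λ σ →
        ∑ m (λ τ → wt (star (t ∷ ts)) ((a ∷ b ∷ σ) ++ τ) ℚ.* g (dot (leaves (t ∷ ts)) (σ ++ τ))))
        ≡⟨ ∑-cong (size ts) (λ σ → trans (∑-cong m (step σ)) (∑-*ˡ m (wt (star ts) (a ∷ b ∷ σ)) _)) ⟩
      ∑ (size ts) (λ σ → wt (star ts) (a ∷ b ∷ σ) ℚ.* transfer s g (dot (leaves ts) σ))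
        ≡⟨ ∑-star ts a b (transfer s g) ⟩
      transfers ts (a ∷ b ∷ []) (transfer s g) 0 ∎
      where
      open ≡-Reasoning
      s = lookup (a ∷ b ∷ []) t
      step : ∀ σ τ → wt (star (t ∷ ts)) ((a ∷ b ∷ σ) ++ τ) ℚ.* g (dot (leaves (t ∷ ts)) (σ ++ τ)) ≡
             wt (star ts) (a ∷ b ∷ σ) ℚ.*
               (wt ds (insertAt τ u s) ℚ.* g (dot (leaves ts) σ ℕ.+ toℕ (lookup τ v)))
      step σ τ = trans (cong₂ ℚ._*_
        (trans (wt-glue (t ↑ˡ size ts) u (star ts) ds (a ∷ b ∷ σ) τ)
          (cong (λ s → wt (star ts) (a ∷ b ∷ σ) ℚ.* wt ds (insertAt τ u s)) (Vec.lookup-++ˡ (a ∷ b ∷ []) σ t)))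
        (cong g (trans (dot-++ (leaves ts) (single v true) σ τ)
          (cong (dot (leaves ts) σ ℕ.+_) (dot-single v true τ)))))
        (ℚ.*-assoc (wt (star ts) (a ∷ b ∷ σ)) (wt ds (insertAt τ u s)) _)

    rooted-closed : ∀ ts eq a → rooted (closed ts eq) zero a ≡
      transfers ts (a ∷ zero ∷ []) ω 0 ℚ.+ transfers ts (a ∷ suc zero ∷ []) ω 0
    rooted-closed ts eq a = cong₂ ℚ._+_ (half zero) (half (suc zero))
      where
      half : ∀ b → ∑ (size ts) (λ τ → wt (closed ts eq) (a ∷ b ∷ τ)) ≡ transfers ts (a ∷ b ∷ []) ω 0
      half b = trans (∑-cong (size ts) (λ τ → ℚ.*-comm (ω (dot (leaves ts) τ)) (wt (star ts) (a ∷ b ∷ τ))))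
                     (∑-star ts a b ω)

    -- Two diagonal entries of at least `h` leave only `κ h` of a total of at most `(2 + κ) h`. This
    -- excess bounds both the off-diagonal entries and what a diagonal entry has beyond `h`, so the
    -- transfer matrix is nearly `h` times the identity.
    module Bounds (h κ : ℚ) (0≤h : 0ℚ ℚ.≤ h) (0≤κ : 0ℚ ℚ.≤ κ) (2κ≤1 : 2ℚ ℚ.* κ ℚ.≤ 1ℚ)
                  (diagonal : ∀ s → h ℚ.≤ pair s s) (total≤ : total ℚ.≤ (2ℚ ℚ.+ κ) ℚ.* h) where

      total-split′ : ∀ s → total ≡
        (pair s s ℚ.+ pair s (opposite s)) ℚ.+ (pair (opposite s) s ℚ.+ pair (opposite s) (opposite s))
      total-split′ zero       = total-split
      total-split′ (suc zero) = trans total-split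
        (swap (pair zero zero) (pair zero (suc zero)) (pair (suc zero) zero) (pair (suc zero) (suc zero)))
        where
        open +-*-Solver
        swap : ∀ a b c d → (a ℚ.+ b) ℚ.+ (c ℚ.+ d) ≡ (d ℚ.+ c) ℚ.+ (b ℚ.+ a)
        swap = solve 4 (λ a b c d → (a :+ b) :+ (c :+ d) := (d :+ c) :+ (b :+ a)) refl

      pair-diagonal≤ : ∀ s → pair s s ℚ.≤ (1ℚ ℚ.+ κ) ℚ.* h
      pair-diagonal≤ s = ≤-by
        (((2ℚ ℚ.+ κ) ℚ.* h ℚ.- ((a ℚ.+ b) ℚ.+ (c ℚ.+ d))) ℚ.+ (b ℚ.+ c) ℚ.+ (d ℚ.- h))
        (0≤+ (0≤+ (0≤- (subst (ℚ._≤ (2ℚ ℚ.+ κ) ℚ.* h) (total-split′ s) total≤))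
                  (0≤+ (0≤pair s (opposite s)) (0≤pair (opposite s) s)))
             (0≤- (diagonal (opposite s))))
        (identity a b c d h κ)
        where
        a = pair s s
        b = pair s (opposite s)
        c = pair (opposite s) s
        d = pair (opposite s) (opposite s)
        open +-*-Solver
        identity : ∀ a b c d h κ → (1ℚ ℚ.+ κ) ℚ.* h ≡ a ℚ.+
          (((2ℚ ℚ.+ κ) ℚ.* h ℚ.- ((a ℚ.+ b) ℚ.+ (c ℚ.+ d))) ℚ.+ (b ℚ.+ c) ℚ.+ (d ℚ.- h))
        identity = solve 6 (λ a b c d h κ → (con 1ℚ :+ κ) :* h := a :+
          (((con 2ℚ :+ κ) :* h :- ((a :+ b) :+ (c :+ d))) :+ (b :+ c) :+ (d :- h))) refl

      pair-off-diagonal≤ : ∀ s → pair s (opposite s) ℚ.≤ κ ℚ.* h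
      pair-off-diagonal≤ s = ≤-by
        (((2ℚ ℚ.+ κ) ℚ.* h ℚ.- ((a ℚ.+ b) ℚ.+ (c ℚ.+ d))) ℚ.+ c ℚ.+ ((a ℚ.- h) ℚ.+ (d ℚ.- h)))
        (0≤+ (0≤+ (0≤- (subst (ℚ._≤ (2ℚ ℚ.+ κ) ℚ.* h) (total-split′ s) total≤))
                  (0≤pair (opposite s) s))
             (0≤+ (0≤- (diagonal s)) (0≤- (diagonal (opposite s)))))
        (identity a b c d h κ)
        where
        a = pair s s
        b = pair s (opposite s)
        c = pair (opposite s) s
        d = pair (opposite s) (opposite s)
        open +-*-Solver
        identity : ∀ a b c d h κ → κ ℚ.* h ≡ b ℚ.+
          (((2ℚ ℚ.+ κ) ℚ.* h ℚ.- ((a ℚ.+ b) ℚ.+ (c ℚ.+ d))) ℚ.+ c ℚ.+ ((a ℚ.- h) ℚ.+ (d ℚ.- h)))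
        identity = solve 6 (λ a b c d h κ → κ :* h := b :+
          (((con 2ℚ :+ κ) :* h :- ((a :+ b) :+ (c :+ d))) :+ c :+ ((a :- h) :+ (d :- h)))) refl

      transfer-pair′ : ∀ s g c → transfer s g c ≡
        pair s s ℚ.* g (c ℕ.+ toℕ s) ℚ.+ pair s (opposite s) ℚ.* g (c ℕ.+ toℕ (opposite s))
      transfer-pair′ zero       g c = transfer-pair zero g c
      transfer-pair′ (suc zero) g c = trans (transfer-pair (suc zero) g c)
        (ℚ.+-comm (pair (suc zero) zero ℚ.* g (c ℕ.+ 0)) (pair (suc zero) (suc zero) ℚ.* g (c ℕ.+ 1)))

      0≤transfer : ∀ s {g} → (∀ c → 0ℚ ℚ.≤ g c) → ∀ c → 0ℚ ℚ.≤ transfer s g c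
      0≤transfer s 0≤g c = ∑-nonneg m (λ τ → 0≤* (0≤wt ds (insertAt τ u s)) (0≤g (c ℕ.+ toℕ (lookup τ v))))

      transfer≥ : ∀ s {g} → (∀ c → 0ℚ ℚ.≤ g c) → ∀ c → h ℚ.* g (c ℕ.+ toℕ s) ℚ.≤ transfer s g c
      transfer≥ s {g} 0≤g c = begin
        h ℚ.* g (c ℕ.+ toℕ s)
          ≤⟨ *-monoʳ (0≤g (c ℕ.+ toℕ s)) (diagonal s) ⟩
        pair s s ℚ.* g (c ℕ.+ toℕ s)
          ≤⟨ p≤p+q (0≤* (0≤pair s (opposite s)) (0≤g (c ℕ.+ toℕ (opposite s)))) ⟩
        pair s s ℚ.* g (c ℕ.+ toℕ s) ℚ.+ pair s (opposite s) ℚ.* g (c ℕ.+ toℕ (opposite s))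
          ≡⟨ sym (transfer-pair′ s g c) ⟩
        transfer s g c ∎
        where open ℚ.≤-Reasoning

      transfer≤ : ∀ s {g W} → (∀ c → 0ℚ ℚ.≤ g c) → (∀ c → g c ℚ.≤ W) → ∀ c →
                  transfer s g c ℚ.≤ h ℚ.* (g (c ℕ.+ toℕ s) ℚ.+ 2ℚ ℚ.* κ ℚ.* W)
      transfer≤ s {g} {W} 0≤g g≤W c = begin
        transfer s g c
          ≡⟨ transfer-pair′ s g c ⟩
        pair s s ℚ.* x ℚ.+ pair s (opposite s) ℚ.* g (c ℕ.+ toℕ (opposite s))
          ≤⟨ ℚ.+-mono-≤ (*-monoʳ (0≤g (c ℕ.+ toℕ s)) (pair-diagonal≤ s))
               (*-mono-≤ (0≤pair s (opposite s)) (ℚ.≤-trans (0≤g 0) (g≤W 0)) (pair-off-diagonal≤ s)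
                   (g≤W (c ℕ.+ toℕ (opposite s)))) ⟩
        (1ℚ ℚ.+ κ) ℚ.* h ℚ.* x ℚ.+ κ ℚ.* h ℚ.* W
          -- One `κ W` comes from the off-diagonal entry, the other from enlarging the diagonal
          -- excess `κ x`, which makes the error independent of `g` and `c`.
          ≤⟨ ≤-by (κ ℚ.* h ℚ.* (W ℚ.- x)) (0≤* (0≤* 0≤κ 0≤h) (0≤- (g≤W (c ℕ.+ toℕ s)))) (identity h κ x W) ⟩
        h ℚ.* (x ℚ.+ 2ℚ ℚ.* κ ℚ.* W) ∎
        where
        x = g (c ℕ.+ toℕ s)
        open ℚ.≤-Reasoning
        open +-*-Solver
        identity : ∀ h κ x W → h ℚ.* (x ℚ.+ 2ℚ ℚ.* κ ℚ.* W) ≡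
          ((1ℚ ℚ.+ κ) ℚ.* h ℚ.* x ℚ.+ κ ℚ.* h ℚ.* W) ℚ.+ κ ℚ.* h ℚ.* (W ℚ.- x)
        identity = solve 4 (λ h κ x W → h :* (x :+ con 2ℚ :* κ :* W) :=
          ((con 1ℚ :+ κ) :* h :* x :+ κ :* h :* W) :+ κ :* h :* (W :- x)) refl

      transfers≥ : ∀ ts ab {g} → (∀ c → 0ℚ ℚ.≤ g c) → ∀ c →
                   h ^ List.length ts ℚ.* g (c ℕ.+ level ab ts) ℚ.≤ transfers ts ab g c
      transfers≥ []       ab {g} 0≤g c =
        ℚ.≤-reflexive (trans (ℚ.*-identityˡ (g (c ℕ.+ 0))) (cong g (ℕ.+-identityʳ c)))
      transfers≥ (t ∷ ts) ab {g} 0≤g c = begin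
        h ℚ.* H ℚ.* g (c ℕ.+ (level ab ts ℕ.+ toℕ s))
          ≡⟨ trans (cong (ℚ._* g (c ℕ.+ (level ab ts ℕ.+ toℕ s))) (ℚ.*-comm h H))
                  (ℚ.*-assoc H h (g (c ℕ.+ (level ab ts ℕ.+ toℕ s)))) ⟩
        H ℚ.* (h ℚ.* g (c ℕ.+ (level ab ts ℕ.+ toℕ s)))
          ≡⟨ cong (λ i → H ℚ.* (h ℚ.* g i)) (sym (ℕ.+-assoc c (level ab ts) (toℕ s))) ⟩
        H ℚ.* (h ℚ.* g (c ℕ.+ level ab ts ℕ.+ toℕ s))
          ≤⟨ *-monoˡ (0≤^ 0≤h (List.length ts)) (transfer≥ s 0≤g (c ℕ.+ level ab ts)) ⟩
        H ℚ.* transfer s g (c ℕ.+ level ab ts)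
          ≤⟨ transfers≥ ts ab (0≤transfer s 0≤g) c ⟩
        transfers ts ab (transfer s g) c ∎
        where
        open ℚ.≤-Reasoning
        s = lookup ab t
        H = h ^ List.length ts

      transfers≤ : ∀ ts ab {g W} → (∀ c → 0ℚ ℚ.≤ g c) → (∀ c → g c ℚ.≤ W) → ∀ c →
                   transfers ts ab g c ℚ.≤
                   h ^ List.length ts ℚ.* (g (c ℕ.+ level ab ts) ℚ.+ slack (List.length ts) ℚ.* κ ℚ.* W)
      transfers≤ []       ab {g} {W} 0≤g g≤W c = ℚ.≤-reflexive
        (trans (cong g (sym (ℕ.+-identityʳ c))) (identity (g (c ℕ.+ 0)) κ W))
        where
        open +-*-Solver
        identity : ∀ x κ W → x ≡ 1ℚ ℚ.* (x ℚ.+ 0ℚ ℚ.* κ ℚ.* W)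
        identity = solve 3 (λ x κ W → x := con 1ℚ :* (x :+ con 0ℚ :* κ :* W)) refl
      transfers≤ (t ∷ ts) ab {g} {W} 0≤g g≤W c = begin
        transfers ts ab (transfer s g) c
          ≤⟨ transfers≤ ts ab (0≤transfer s 0≤g) transfer≤2hW c ⟩
        H ℚ.* (transfer s g (c ℕ.+ level ab ts) ℚ.+ C ℚ.* κ ℚ.* (2ℚ ℚ.* h ℚ.* W))
          ≤⟨ *-monoˡ (0≤^ 0≤h (List.length ts)) (ℚ.+-monoˡ-≤ (C ℚ.* κ ℚ.* (2ℚ ℚ.* h ℚ.* W))
              (transfer≤ s 0≤g g≤W (c ℕ.+ level ab ts))) ⟩
        H ℚ.* (h ℚ.* (g (c ℕ.+ level ab ts ℕ.+ toℕ s) ℚ.+ 2ℚ ℚ.* κ ℚ.* W) ℚ.+ C ℚ.* κ ℚ.* (2ℚ ℚ.* h ℚ.* W))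
          ≡⟨ identity H h (g (c ℕ.+ level ab ts ℕ.+ toℕ s)) κ W C ⟩
        h ℚ.* H ℚ.* (g (c ℕ.+ level ab ts ℕ.+ toℕ s) ℚ.+ (2ℚ ℚ.+ 2ℚ ℚ.* C) ℚ.* κ ℚ.* W)
          ≡⟨ cong (λ i → h ℚ.* H ℚ.* (g i ℚ.+ (2ℚ ℚ.+ 2ℚ ℚ.* C) ℚ.* κ ℚ.* W))
               (ℕ.+-assoc c (level ab ts) (toℕ s)) ⟩
        h ℚ.* H ℚ.* (g (c ℕ.+ (level ab ts ℕ.+ toℕ s)) ℚ.+ (2ℚ ℚ.+ 2ℚ ℚ.* C) ℚ.* κ ℚ.* W) ∎
        where
        open ℚ.≤-Reasoning
        s = lookup ab t
        H = h ^ List.length ts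
        C = slack (List.length ts)
        0≤W : 0ℚ ℚ.≤ W
        0≤W = ℚ.≤-trans (0≤g 0) (g≤W 0)
        -- The induction hypothesis needs a bound for the transferred function. From `x ≤ W` and
        -- `2 κ ≤ 1` it is `h (W + W)`, the doubling recorded in `slack`.
        transfer≤2hW : ∀ c → transfer s g c ℚ.≤ 2ℚ ℚ.* h ℚ.* W
        transfer≤2hW c = ℚ.≤-trans (transfer≤ s 0≤g g≤W c) (≤-by
          (h ℚ.* ((W ℚ.- g (c ℕ.+ toℕ s)) ℚ.+ (1ℚ ℚ.- 2ℚ ℚ.* κ) ℚ.* W))
          (0≤* 0≤h (0≤+ (0≤- (g≤W (c ℕ.+ toℕ s))) (0≤* (0≤- 2κ≤1) 0≤W)))
          (bound h (g (c ℕ.+ toℕ s)) κ W))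
          where
          open +-*-Solver
          bound : ∀ h x κ W → 2ℚ ℚ.* h ℚ.* W ≡
            h ℚ.* (x ℚ.+ 2ℚ ℚ.* κ ℚ.* W) ℚ.+ h ℚ.* ((W ℚ.- x) ℚ.+ (1ℚ ℚ.- 2ℚ ℚ.* κ) ℚ.* W)
          bound = solve 4 (λ h x κ W → con 2ℚ :* h :* W :=
            h :* (x :+ con 2ℚ :* κ :* W) :+ h :* ((W :- x) :+ (con 1ℚ :- con 2ℚ :* κ) :* W)) refl
        open +-*-Solver
        identity : ∀ H h x κ W C →
          H ℚ.* (h ℚ.* (x ℚ.+ 2ℚ ℚ.* κ ℚ.* W) ℚ.+ C ℚ.* κ ℚ.* (2ℚ ℚ.* h ℚ.* W)) ≡
          h ℚ.* H ℚ.* (x ℚ.+ (2ℚ ℚ.+ 2ℚ ℚ.* C) ℚ.* κ ℚ.* W)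
        identity = solve 6 (λ H h x κ W C →
          H :* (h :* (x :+ con 2ℚ :* κ :* W) :+ C :* κ :* (con 2ℚ :* h :* W)) :=
          h :* H :* (x :+ (con 2ℚ :+ con 2ℚ :* C) :* κ :* W)) refl

      module _ {W : ℚ} (ω≤W : ∀ c → ω c ℚ.≤ W) (ts : List (Fin 2)) (eq : List.length ts ≡ k) where

        private
          n = List.length ts
          V = rooted (closed ts eq) zero

        rooted-closed≥ : ∀ a → h ^ n ℚ.* bias ω ts a ℚ.≤ V a
        rooted-closed≥ a = begin
          h ^ n ℚ.* (ω (level (a ∷ zero ∷ []) ts) ℚ.+ ω (level (a ∷ suc zero ∷ []) ts))
            ≡⟨ ℚ.*-distribˡ-+ (h ^ n) (ω (level (a ∷ zero ∷ []) ts)) (ω (level (a ∷ suc zero ∷ []) ts)) ⟩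
          h ^ n ℚ.* ω (level (a ∷ zero ∷ []) ts) ℚ.+ h ^ n ℚ.* ω (level (a ∷ suc zero ∷ []) ts)
            ≤⟨ ℚ.+-mono-≤ (transfers≥ ts (a ∷ zero ∷ []) 0≤ω 0) (transfers≥ ts (a ∷ suc zero ∷ []) 0≤ω 0) ⟩
          transfers ts (a ∷ zero ∷ []) ω 0 ℚ.+ transfers ts (a ∷ suc zero ∷ []) ω 0
            ≡⟨ sym (rooted-closed ts eq a) ⟩
          V a ∎
          where open ℚ.≤-Reasoning

        rooted-closed≤ : ∀ a → V a ℚ.≤ h ^ n ℚ.* (bias ω ts a ℚ.+ 2ℚ ℚ.* (slack n ℚ.* κ ℚ.* W))
        rooted-closed≤ a = begin
          V a
            ≡⟨ rooted-closed ts eq a ⟩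
          transfers ts (a ∷ zero ∷ []) ω 0 ℚ.+ transfers ts (a ∷ suc zero ∷ []) ω 0
            ≤⟨ ℚ.+-mono-≤ (transfers≤ ts (a ∷ zero ∷ []) 0≤ω ω≤W 0)
                 (transfers≤ ts (a ∷ suc zero ∷ []) 0≤ω ω≤W 0) ⟩
          h ^ n ℚ.* (x ℚ.+ S) ℚ.+ h ^ n ℚ.* (y ℚ.+ S)
            ≡⟨ identity (h ^ n) x y S ⟩
          h ^ n ℚ.* (bias ω ts a ℚ.+ 2ℚ ℚ.* S) ∎
          where
          x = ω (level (a ∷ zero ∷ []) ts)
          y = ω (level (a ∷ suc zero ∷ []) ts)
          S = slack n ℚ.* κ ℚ.* W
          open ℚ.≤-Reasoning
          open +-*-Solver
          identity : ∀ H x y S → H ℚ.* (x ℚ.+ S) ℚ.+ H ℚ.* (y ℚ.+ S) ≡ H ℚ.* ((x ℚ.+ y) ℚ.+ 2ℚ ℚ.* S)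
          identity = solve 4 (λ H x y S → H :* (x :+ S) :+ H :* (y :+ S) := H :* ((x :+ y) :+ con 2ℚ :* S)) refl

        module _ {e θ : ℚ} (s : Spin) (0≤e : 0ℚ ℚ.≤ e) (0≤θ : 0ℚ ℚ.≤ θ)
                 (error≤e : 2ℚ ℚ.* (slack n ℚ.* κ ℚ.* W) ℚ.≤ e) (θ-small : θ ℚ.* (2ℚ ℚ.* W) ℚ.≤ e)
                 (gap : bias ω ts (opposite s) ℚ.+ 2ℚ ℚ.* e ℚ.≤ bias ω ts s) where

          private
            L  = bias ω ts s
            L′ = bias ω ts (opposite s)
            0≤L′ : 0ℚ ℚ.≤ L′
            0≤L′ = 0≤+ (0≤ω _) (0≤ω _)
            0≤2e : 0ℚ ℚ.≤ 2ℚ ℚ.* e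
            0≤2e = 0≤* (ℚ.nonNegative⁻¹ 2ℚ) 0≤e

          -- The gap `2 e` is spent in halves: one `e` covers the error of the gadgets, the other
          -- the factor `1 + θ`, since `θ (L′ + e) ≤ θ · 2 W ≤ e`.
          closed-gap : (1ℚ ℚ.+ θ) ℚ.* V (opposite s) ℚ.≤ V s
          closed-gap = begin
            (1ℚ ℚ.+ θ) ℚ.* V (opposite s)
              ≤⟨ *-monoˡ (0≤+ 0≤1 0≤θ) (ℚ.≤-trans (rooted-closed≤ (opposite s))
                   (*-monoˡ (0≤^ 0≤h n) (ℚ.+-monoʳ-≤ L′ error≤e))) ⟩
            (1ℚ ℚ.+ θ) ℚ.* (h ^ n ℚ.* (L′ ℚ.+ e))
              ≡⟨ expand θ (h ^ n) L′ e ⟩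
            h ^ n ℚ.* ((L′ ℚ.+ e) ℚ.+ θ ℚ.* (L′ ℚ.+ e))
              ≤⟨ *-monoˡ (0≤^ 0≤h n) (ℚ.+-monoʳ-≤ (L′ ℚ.+ e) (ℚ.≤-trans (*-monoˡ 0≤θ L′+e≤2W) θ-small)) ⟩
            h ^ n ℚ.* ((L′ ℚ.+ e) ℚ.+ e)
              ≡⟨ cong (h ^ n ℚ.*_) (regroup L′ e) ⟩
            h ^ n ℚ.* (L′ ℚ.+ 2ℚ ℚ.* e)
              ≤⟨ *-monoˡ (0≤^ 0≤h n) gap ⟩
            h ^ n ℚ.* L
              ≤⟨ rooted-closed≥ s ⟩
            V s ∎
            where
            open ℚ.≤-Reasoning
            open +-*-Solver
            expand : ∀ θ H L e → (1ℚ ℚ.+ θ) ℚ.* (H ℚ.* (L ℚ.+ e)) ≡ H ℚ.* ((L ℚ.+ e) ℚ.+ θ ℚ.* (L ℚ.+ e))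
            expand = solve 4 (λ θ H L e →
              (con 1ℚ :+ θ) :* (H :* (L :+ e)) := H :* ((L :+ e) :+ θ :* (L :+ e))) refl
            regroup : ∀ L e → (L ℚ.+ e) ℚ.+ e ≡ L ℚ.+ 2ℚ ℚ.* e
            regroup = solve 2 (λ L e → (L :+ e) :+ e := L :+ con 2ℚ :* e) refl
            double : ∀ W → W ℚ.+ W ≡ 2ℚ ℚ.* W
            double = solve 1 (λ W → W :+ W := con 2ℚ :* W) refl
            L′+e≤2W : L′ ℚ.+ e ℚ.≤ 2ℚ ℚ.* W
            L′+e≤2W = begin
              L′ ℚ.+ e          ≤⟨ p≤p+q 0≤e ⟩
              (L′ ℚ.+ e) ℚ.+ e  ≡⟨ regroup L′ e ⟩
              L′ ℚ.+ 2ℚ ℚ.* e   ≤⟨ gap ⟩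
              L                 ≤⟨ ℚ.+-mono-≤ (ω≤W _) (ω≤W _) ⟩
              W ℚ.+ W           ≡⟨ double W ⟩
              2ℚ ℚ.* W          ∎

          bouquet-gap : ∀ M → (1ℚ ℚ.+ M · θ) ℚ.* rooted (Bouquet.bouquet (closed ts eq) M) zero (opposite s) ℚ.≤
                              rooted (Bouquet.bouquet (closed ts eq) M) zero s
          bouquet-gap M = subst₂ (λ y x → (1ℚ ℚ.+ M · θ) ℚ.* y ℚ.≤ x)
            (sym (rooted-bouquet (closed ts eq) M (opposite s))) (sym (rooted-bouquet (closed ts eq) M s))
            (bernoulli (0≤rooted (closed ts eq) zero (opposite s)) 0≤θ closed-gap M)

          -- The gap also forces the larger bias to be at least `2 e`. The resulting lower bound
          -- serves to prove the partition function of the bouquet positive.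
          bouquet≥ : ∀ M → (h ^ n ℚ.* (2ℚ ℚ.* e)) ^ M ℚ.≤ rooted (Bouquet.bouquet (closed ts eq) M) zero s
          bouquet≥ M = subst ((h ^ n ℚ.* (2ℚ ℚ.* e)) ^ M ℚ.≤_) (sym (rooted-bouquet (closed ts eq) M s))
            (^-mono (0≤* (0≤^ 0≤h n) 0≤2e)
              (ℚ.≤-trans (*-monoˡ (0≤^ 0≤h n) (ℚ.≤-trans (q≤p+q 0≤L′) gap)) (rooted-closed≥ s)) M)

-- Real numbers

both : ∀ {P Q} → Eventually P → Eventually Q → Eventually (λ n → P n × Q n)
both (M , p) (N , q) = M ℕ.⊔ N , λ n ≤n →
  p n (ℕ.m⊔n≤o⇒m≤o M N ≤n) , q n (ℕ.m⊔n≤o⇒n≤o M N ≤n)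

mapᴱ : ∀ {P Q : ℕ → Set} → (∀ n → P n → Q n) → Eventually P → Eventually Q
mapᴱ f (N , p) = N , λ n N≤n → f n (p n N≤n)

archimedean : ∀ {p} → 0ℚ ℚ.< p → ∃[ M ] 1ℚ ℚ.≤ M · p
archimedean {ℚ.mkℚ (ℤ.+ zero)   d c} 0<p = contradiction 0<p (ℚ.<-irrefl (sym (ℚ.≃⇒≡ (ℚ.*≡* refl))))
archimedean {ℚ.mkℚ ℤ.-[1+ a ]   d c} (ℚ.*<* ())
-- The denominator of `p` is `suc d`, and that many copies of `p` add up to its numerator
-- `suc a ≥ 1`. Unnormalised fractions keep the denominator fixed while adding.
archimedean {p@(ℚ.mkℚ (ℤ.+ suc a) d c)} 0<p = suc d , ℚ.toℚᵘ-cancel-≤ (begin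
  ℚᵘ.1ℚᵘ                              ≤⟨ ℚᵘ.*≤* (ℤ.+≤+ 1≤) ⟩
  ℚᵘ.mkℚᵘ (+ (suc d ℕ.* suc a)) d     ≃⟨ ℚᵘ.≃-sym (multiple (suc d)) ⟩
  ℚ.toℚᵘ (suc d · p)                  ∎)
  where
  open ℚᵘ.≤-Reasoning
  1≤ : suc (d ℕ.+ 0) ℕ.≤ (suc d ℕ.* suc a) ℕ.* 1
  1≤ = subst₂ ℕ._≤_ (sym (cong suc (ℕ.+-identityʳ d))) (sym (ℕ.*-identityʳ (suc d ℕ.* suc a)))
              (ℕ.m≤m*n (suc d) (suc a))
  common : ∀ x y d → ℚᵘ.mkℚᵘ x d ℚᵘ.+ ℚᵘ.mkℚᵘ y d ℚᵘ.≃ ℚᵘ.mkℚᵘ (x ℤ.+ y) d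
  common x y d = ℚᵘ.*≡* (identity x y (+ suc d))
    where
    open ℤ.+-*-Solver
    identity : ∀ x y d → (x ℤ.* d ℤ.+ y ℤ.* d) ℤ.* d ≡ (x ℤ.+ y) ℤ.* (d ℤ.* d)
    identity = solve 3 (λ x y d → (x :* d :+ y :* d) :* d := (x :+ y) :* (d :* d)) refl
  multiple : ∀ n → ℚ.toℚᵘ (n · p) ℚᵘ.≃ ℚᵘ.mkℚᵘ (+ (n ℕ.* suc a)) d
  multiple zero    = ℚᵘ.*≡* refl
  multiple (suc n) = ℚᵘ.≃-trans (ℚ.toℚᵘ-homo-+ p (n · p))
    (ℚᵘ.≃-trans (ℚᵘ.+-congʳ (ℚ.toℚᵘ p) (multiple n)) (common (+ suc a) (+ (n ℕ.* suc a)) d))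

half : ∀ {ε} → 0ℚ ℚ.< ε → ∃[ δ ] (0ℚ ℚ.< δ × δ ℚ.+ δ ≡ ε)
half {ε} 0<ε with divide 0<ε (ℚ.positive⁻¹ 2ℚ)
... | δ , 0<δ , eq = δ , 0<δ , trans (double δ) eq
  where
  open +-*-Solver
  double : ∀ a → a ℚ.+ a ≡ a ℚ.* 2ℚ
  double = solve 1 (λ a → a :+ a := a :* con 2ℚ) refl

∣-∣-comm : ∀ p q → ℚ.∣ p ℚ.- q ∣ ≡ ℚ.∣ q ℚ.- p ∣
∣-∣-comm p q = trans (sym (ℚ.∣-p∣≡∣p∣ (p ℚ.- q))) (cong ℚ.∣_∣ (flip p q))
  where
  open +-*-Solver
  flip : ∀ p q → ℚ.- (p ℚ.- q) ≡ q ℚ.- p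
  flip = solve 2 (λ p q → :- (p :- q) := q :- p) refl

p≤∣p∣ : ∀ p → p ℚ.≤ ℚ.∣ p ∣
p≤∣p∣ p with ℚ.∣p∣≡p∨∣p∣≡-p p
... | inj₁ eq = ℚ.≤-reflexive (sym eq)
... | inj₂ eq = ≤-by (ℚ.∣ p ∣ ℚ.+ ℚ.∣ p ∣) (0≤+ (ℚ.0≤∣p∣ p) (ℚ.0≤∣p∣ p))
  (subst (λ q → q ≡ p ℚ.+ (q ℚ.+ q)) (sym eq) (cancel p))
  where
  open +-*-Solver
  cancel : ∀ p → ℚ.- p ≡ p ℚ.+ (ℚ.- p ℚ.+ ℚ.- p)
  cancel = solve 1 (λ p → :- p := p :+ (:- p :+ :- p)) refl

∣p∣≤ : ∀ {p q} → p ℚ.≤ q → ℚ.- p ℚ.≤ q → ℚ.∣ p ∣ ℚ.≤ q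
∣p∣≤ {p} {q} p≤q -p≤q with ℚ.∣p∣≡p∨∣p∣≡-p p
... | inj₁ eq = subst (ℚ._≤ q) (sym eq) p≤q
... | inj₂ eq = subst (ℚ._≤ q) (sym eq) -p≤q

∣p-q∣≤⇒p≤q+ : ∀ {p q ε} → ℚ.∣ p ℚ.- q ∣ ℚ.≤ ε → p ℚ.≤ q ℚ.+ ε
∣p-q∣≤⇒p≤q+ {p} {q} {ε} h = subst (ℚ._≤ q ℚ.+ ε) (cancel p q)
  (ℚ.+-monoʳ-≤ q (ℚ.≤-trans (p≤∣p∣ (p ℚ.- q)) h))
  where
  open +-*-Solver
  cancel : ∀ p q → q ℚ.+ (p ℚ.- q) ≡ p
  cancel = solve 2 (λ p q → q :+ (p :- q) := p) refl

≡⇒≃ : ∀ {x y : ℝ} → Eventually (λ n → seq x n ≡ seq y n) → x ≃ y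
≡⇒≃ {x} {y} ev ε 0<ε = mapᴱ (λ n eq → subst (ℚ._≤ ε)
  (sym (cong ℚ.∣_∣ (trans (cong (ℚ._- seq y n) eq) (ℚ.+-inverseʳ (seq y n))))) (ℚ.<⇒≤ 0<ε)) ev

≗⇒≃ : ∀ {x y : ℝ} → (∀ n → seq x n ≡ seq y n) → x ≃ y
≗⇒≃ {x} {y} eq = ≡⇒≃ {x} {y} (0 , λ n _ → eq n)

≃-refl : ∀ {x : ℝ} → x ≃ x
≃-refl {x} = ≗⇒≃ {x} {x} (λ _ → refl)

≃-sym : ∀ {x y : ℝ} → x ≃ y → y ≃ x
≃-sym {x} {y} x≃y ε 0<ε = mapᴱ (λ n → subst (ℚ._≤ ε) (∣-∣-comm (seq x n) (seq y n))) (x≃y ε 0<ε)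

triangle : ∀ {ε δ} a b c → ℚ.∣ a ℚ.- b ∣ ℚ.≤ ε → ℚ.∣ b ℚ.- c ∣ ℚ.≤ δ → ℚ.∣ a ℚ.- c ∣ ℚ.≤ ε ℚ.+ δ
triangle {ε} {δ} a b c p q = begin
  ℚ.∣ a ℚ.- c ∣                     ≡⟨ cong ℚ.∣_∣ (split a b c) ⟩
  ℚ.∣ (a ℚ.- b) ℚ.+ (b ℚ.- c) ∣     ≤⟨ ℚ.∣p+q∣≤∣p∣+∣q∣ (a ℚ.- b) (b ℚ.- c) ⟩
  ℚ.∣ a ℚ.- b ∣ ℚ.+ ℚ.∣ b ℚ.- c ∣   ≤⟨ ℚ.+-mono-≤ p q ⟩
  ε ℚ.+ δ                           ∎
  where
  open ℚ.≤-Reasoning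
  open +-*-Solver
  split : ∀ a b c → a ℚ.- c ≡ (a ℚ.- b) ℚ.+ (b ℚ.- c)
  split = solve 3 (λ a b c → a :- c := (a :- b) :+ (b :- c)) refl

≃-trans : ∀ {x y z : ℝ} → x ≃ y → y ≃ z → x ≃ z
≃-trans {x} {y} {z} x≃y y≃z ε 0<ε = let (δ , 0<δ , eq) = half 0<ε in
  mapᴱ (λ n (p , q) → subst (ℚ.∣ seq x n ℚ.- seq z n ∣ ℚ.≤_) eq
  (triangle (seq x n) (seq y n) (seq z n) p q)) (both (x≃y δ 0<δ) (y≃z δ 0<δ))

+-cong : ∀ {x x′ y y′ : ℝ} → x ≃ x′ → y ≃ y′ → x + y ≃ x′ + y′
+-cong {x} {x′} {y} {y′} p q ε 0<ε = let (δ , 0<δ , eq) = half 0<ε in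
  mapᴱ (λ n (p , q) → subst (ℚ.∣ (seq x n ℚ.+ seq y n) ℚ.- (seq x′ n ℚ.+ seq y′ n) ∣ ℚ.≤_) eq
  (close (seq x n) (seq x′ n) (seq y n) (seq y′ n) p q)) (both (p δ 0<δ) (q δ 0<δ))
  where
  close : ∀ {δ} a a′ b b′ → ℚ.∣ a ℚ.- a′ ∣ ℚ.≤ δ → ℚ.∣ b ℚ.- b′ ∣ ℚ.≤ δ →
          ℚ.∣ (a ℚ.+ b) ℚ.- (a′ ℚ.+ b′) ∣ ℚ.≤ δ ℚ.+ δ
  close {δ} a a′ b b′ p q = begin
    ℚ.∣ (a ℚ.+ b) ℚ.- (a′ ℚ.+ b′) ∣       ≡⟨ cong ℚ.∣_∣ (regroup a a′ b b′) ⟩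
    ℚ.∣ (a ℚ.- a′) ℚ.+ (b ℚ.- b′) ∣       ≤⟨ ℚ.∣p+q∣≤∣p∣+∣q∣ (a ℚ.- a′) (b ℚ.- b′) ⟩
    ℚ.∣ a ℚ.- a′ ∣ ℚ.+ ℚ.∣ b ℚ.- b′ ∣     ≤⟨ ℚ.+-mono-≤ p q ⟩
    δ ℚ.+ δ                               ∎
    where
    open ℚ.≤-Reasoning
    open +-*-Solver
    regroup : ∀ a a′ b b′ → (a ℚ.+ b) ℚ.- (a′ ℚ.+ b′) ≡ (a ℚ.- a′) ℚ.+ (b ℚ.- b′)
    regroup = solve 4 (λ a a′ b b′ → (a :+ b) :- (a′ :+ b′) := (a :- a′) :+ (b :- b′)) refl

*-cong : ∀ {x x′ y y′ : ℝ} → x ≃ x′ → y ≃ y′ → x * y ≃ x′ * y′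
*-cong {x} {x′} {y} {y′} p q ε 0<ε =
  let (B , 0<B , x≤B)  = bounded {seq x} (cauchy x)
      (C , 0<C , y′≤C) = bounded {seq y′} (cauchy y′)
      (δ , 0<δ , eq)   = divide {ε} {B ℚ.+ C} 0<ε (0<+ {B} {C} 0<B 0<C)
  in mapᴱ (λ n ((x≤B , y′≤C) , p , q) →
  subst (ℚ.∣ seq x n ℚ.* seq y n ℚ.- seq x′ n ℚ.* seq y′ n ∣ ℚ.≤_) eq
    (*-close {B} {C} {δ} (seq x n) (seq y n) (seq x′ n) (seq y′ n) (ℚ.<⇒≤ 0<C) (ℚ.<⇒≤ 0<δ) x≤B y′≤C p q))
  (both (both x≤B y′≤C) (both (p δ 0<δ) (q δ 0<δ)))

0<⇒seq : ∀ {x : ℝ} → 0ℝ < x → ∃[ d ] (0ℚ ℚ.< d × Eventually λ n → d ℚ.≤ seq x n)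
0<⇒seq {x} (d , 0<d , ev) = d , 0<d , mapᴱ (λ n → subst (ℚ._≤ seq x n) (ℚ.+-identityˡ d)) ev

seq⇒0< : ∀ {x : ℝ} {d} → 0ℚ ℚ.< d → Eventually (λ n → d ℚ.≤ seq x n) → 0ℝ < x
seq⇒0< {x} {d} 0<d ev = d , 0<d , mapᴱ (λ n → subst (ℚ._≤ seq x n) (sym (ℚ.+-identityˡ d))) ev

0<-resp-≃ : ∀ {x y : ℝ} → x ≃ y → 0ℝ < x → 0ℝ < y
0<-resp-≃ {x} {y} x≃y 0<x =
  let (d , 0<d , d≤x) = 0<⇒seq {x} 0<x
      (δ , 0<δ , eq)  = half 0<d
  in seq⇒0< {y} 0<δ (mapᴱ (λ n (d≤x , close) → cancel (ℚ.≤-trans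
    (subst (ℚ._≤ seq x n) (sym eq) d≤x) (∣p-q∣≤⇒p≤q+ {seq x n} {seq y n} close))) (both d≤x (x≃y δ 0<δ)))
  where
  cancel : ∀ {a b} → a ℚ.+ a ℚ.≤ b ℚ.+ a → a ℚ.≤ b
  cancel {a} {b} h = subst₂ ℚ._≤_ (minus a a) (minus b a) (ℚ.+-monoˡ-≤ (ℚ.- a) h)
    where
    open +-*-Solver
    minus : ∀ a b → a ℚ.+ b ℚ.+ ℚ.- b ≡ a
    minus = solve 2 (λ a b → a :+ b :+ :- b := a) refl

-- Through `1/x · (y · 1/y)` and `1/x · (x · 1/y)`, which reduces the claim to `*-cong`. The outer
-- two equalities are termwise but only eventual, from where `recip` is a true inverse.
1/-cong : ∀ {x y : ℝ} (0<x : 0ℝ < x) (0<y : 0ℝ < y) → x ≃ y → 1/ x ⟨ 0<x ⟩ ≃ 1/ y ⟨ 0<y ⟩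
1/-cong {x} {y} 0<x 0<y x≃y =
  ≃-trans {1/x} {1/x * (y * 1/y)} {1/y}
    (≡⇒≃ {1/x} {1/x * (y * 1/y)} (mapᴱ (λ n eq → sym (trans (cong (recip (seq x n) ℚ.*_)
      (trans (ℚ.*-comm (seq y n) (recip (seq y n))) eq)) (ℚ.*-identityʳ (recip (seq x n))))) (inverse {y} 0<y)))
    (≃-trans {1/x * (y * 1/y)} {1/x * (x * 1/y)} {1/y}
      (*-cong {1/x} {1/x} {y * 1/y} {x * 1/y} (≃-refl {1/x})
        (*-cong {y} {x} {1/y} {1/y} (≃-sym {x} {y} x≃y) (≃-refl {1/y})))
      (≡⇒≃ {1/x * (x * 1/y)} {1/y} (mapᴱ (λ n eq →
        trans (sym (ℚ.*-assoc (recip (seq x n)) (seq x n) (recip (seq y n))))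
          (trans (cong (ℚ._* recip (seq y n)) eq) (ℚ.*-identityˡ (recip (seq y n))))) (inverse {x} 0<x))))
  where
  1/x = 1/ x ⟨ 0<x ⟩
  1/y = 1/ y ⟨ 0<y ⟩
  inverse : ∀ {z} → 0ℝ < z → Eventually (λ n → recip (seq z n) ℚ.* seq z n ≡ 1ℚ)
  inverse {z} 0<z = let (d , 0<d , ev) = 0<⇒seq {z} 0<z in
    mapᴱ (λ n d≤z → recip-inverseˡ (ℚ.<-≤-trans 0<d d≤z)) ev

≥-resp-≃ : ∀ {x y z : ℝ} → x ≃ y → x ≥ z → y ≥ z
≥-resp-≃ {x} {y} {z} x≃y z≤x ε 0<ε = let (δ , 0<δ , eq) = half 0<ε in
  mapᴱ (λ n (z≤x , close) → subst (seq z n ℚ.≤_)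
  (trans (ℚ.+-assoc (seq y n) δ δ) (cong (seq y n ℚ.+_) eq))
  (ℚ.≤-trans z≤x (ℚ.+-monoˡ-≤ δ (∣p-q∣≤⇒p≤q+ {seq x n} {seq y n} close)))) (both (z≤x δ 0<δ) (x≃y δ 0<δ))

∣∣p∣-∣q∣∣≤∣p-q∣ : ∀ p q → ℚ.∣ ℚ.∣ p ∣ ℚ.- ℚ.∣ q ∣ ∣ ℚ.≤ ℚ.∣ p ℚ.- q ∣
∣∣p∣-∣q∣∣≤∣p-q∣ p q = ∣p∣≤ (one-sided p q)
  (subst₂ ℚ._≤_ (flip ℚ.∣ q ∣ ℚ.∣ p ∣) (∣-∣-comm q p) (one-sided q p))
  where
  open +-*-Solver
  flip : ∀ p q → p ℚ.- q ≡ ℚ.- (q ℚ.- p)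
  flip = solve 2 (λ p q → p :- q := :- (q :- p)) refl
  split : ∀ p q → (p ℚ.- q) ℚ.+ q ≡ p
  split = solve 2 (λ p q → (p :- q) :+ q := p) refl
  minus : ∀ p q → (p ℚ.+ q) ℚ.- q ≡ p
  minus = solve 2 (λ p q → (p :+ q) :- q := p) refl
  one-sided : ∀ p q → ℚ.∣ p ∣ ℚ.- ℚ.∣ q ∣ ℚ.≤ ℚ.∣ p ℚ.- q ∣
  one-sided p q = subst (ℚ.∣ p ∣ ℚ.- ℚ.∣ q ∣ ℚ.≤_) (minus ℚ.∣ p ℚ.- q ∣ ℚ.∣ q ∣)
    (ℚ.+-monoˡ-≤ (ℚ.- ℚ.∣ q ∣) (subst (λ r → ℚ.∣ r ∣ ℚ.≤ ℚ.∣ p ℚ.- q ∣ ℚ.+ ℚ.∣ q ∣) (split p q)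
      (ℚ.∣p+q∣≤∣p∣+∣q∣ (p ℚ.- q) q)))

abs : ℝ → ℝ
abs x = mkℝ (λ n → ℚ.∣ seq x n ∣) λ ε 0<ε → case (cauchy x ε 0<ε)
  where
  case : ∀ {ε} → ∃[ N ] (∀ m n → N ℕ.≤ m → N ℕ.≤ n → ℚ.∣ seq x m ℚ.- seq x n ∣ ℚ.≤ ε) →
         ∃[ N ] (∀ m n → N ℕ.≤ m → N ℕ.≤ n → ℚ.∣ ℚ.∣ seq x m ∣ ℚ.- ℚ.∣ seq x n ∣ ∣ ℚ.≤ ε)
  case (N , h) = N , λ m n ≤m ≤n → ℚ.≤-trans (∣∣p∣-∣q∣∣≤∣p-q∣ (seq x m) (seq x n)) (h m n ≤m ≤n)

-- Terms of a non-negative real may be negative, but eventually none lies below `- δ`. A negative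
-- term `p` then differs from `∣ p ∣` by `- 2 p ≤ 2 δ = ε`.
0≤⇒≃abs : ∀ {x : ℝ} → 0ℝ ≤ x → x ≃ abs x
0≤⇒≃abs {x} 0≤x ε 0<ε = let (δ , 0<δ , eq) = half 0<ε in
  mapᴱ (λ n h → close δ eq (seq x n) h (ℚ.∣p∣≡p∨∣p∣≡-p (seq x n))) (0≤x δ 0<δ)
  where
  close : ∀ δ → δ ℚ.+ δ ≡ ε → ∀ p → 0ℚ ℚ.≤ p ℚ.+ δ → ℚ.∣ p ∣ ≡ p ⊎ ℚ.∣ p ∣ ≡ ℚ.- p → ℚ.∣ p ℚ.- ℚ.∣ p ∣ ∣ ℚ.≤ ε
  close δ eq p h (inj₁ e) = subst (ℚ._≤ ε)
    (sym (cong ℚ.∣_∣ (trans (cong (λ q → p ℚ.- q) e) (ℚ.+-inverseʳ p)))) (ℚ.<⇒≤ 0<ε)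
  close δ eq p h (inj₂ e) = subst (λ q → ℚ.∣ p ℚ.- q ∣ ℚ.≤ ε) (sym e) (∣p∣≤
      (≤-by (ℚ.- p ℚ.+ ℚ.- p ℚ.+ ε) (0≤+ (0≤+ 0≤-p 0≤-p) (ℚ.<⇒≤ 0<ε)) (up p ε))
      (≤-by ((p ℚ.+ δ) ℚ.+ (p ℚ.+ δ)) (0≤+ h h) (trans (sym eq) (down p δ))))
    where
    0≤-p : 0ℚ ℚ.≤ ℚ.- p
    0≤-p = subst (0ℚ ℚ.≤_) e (ℚ.0≤∣p∣ p)
    open +-*-Solver
    up : ∀ p ε → ε ≡ (p ℚ.- ℚ.- p) ℚ.+ (ℚ.- p ℚ.+ ℚ.- p ℚ.+ ε)
    up = solve 2 (λ p ε → ε := (p :- :- p) :+ (:- p :+ :- p :+ ε)) refl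
    down : ∀ p δ → δ ℚ.+ δ ≡ ℚ.- (p ℚ.- ℚ.- p) ℚ.+ ((p ℚ.+ δ) ℚ.+ (p ℚ.+ δ))
    down = solve 2 (λ p δ → δ :+ δ := :- (p :- :- p) :+ ((p :+ δ) :+ (p :+ δ))) refl

-- Partition functions and probabilities respect `≃`

module _ {A : Set} (h h′ : A → ℝ) (h≃h′ : ∀ a → h a ≃ h′ a) where

  sum-cong : ∀ as → sum (List.map h as) ≃ sum (List.map h′ as)
  sum-cong []       = ≃-refl {0ℝ}
  sum-cong (a ∷ as) = +-cong {h a} {h′ a} {sum (List.map h as)} {sum (List.map h′ as)} (h≃h′ a) (sum-cong as)

  product-cong : ∀ as → product (List.map h as) ≃ product (List.map h′ as)
  product-cong []       = ≃-refl {1ℝ}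
  product-cong (a ∷ as) = *-cong {h a} {h′ a} {product (List.map h as)} {product (List.map h′ as)}
      (h≃h′ a) (product-cong as)

module _ {k : ℕ} (f f′ : Vec Spin k → ℝ) (f≃f′ : ∀ x → f x ≃ f′ x) (H : Hypergraph k) where

  weight-cong : ∀ σ → weight f H σ ≃ weight f′ H σ
  weight-cong σ = product-cong (λ e → f (Vec.map (lookup σ) (endpoints e)))
    (λ e → f′ (Vec.map (lookup σ) (endpoints e)))
    (λ e → f≃f′ (Vec.map (lookup σ) (endpoints e))) (edges H)

  Z-cong : Z f H ≃ Z f′ H
  Z-cong = sum-cong (weight f H) (weight f′ H) weight-cong (configs (order H))

  Pr-cong : ∀ Z>0 Z′>0 {A : Pred (Config (order H)) 0ℓ} (A? : Decidable A) →
            Pr f H Z>0 A? ≃ Pr f′ H Z′>0 A?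
  Pr-cong Z>0 Z′>0 A? = sum-cong (μ f H Z>0) (μ f′ H Z′>0)
    (λ σ → *-cong {weight f H σ} {weight f′ H σ} {1/ Z f H ⟨ Z>0 ⟩} {1/ Z f′ H ⟨ Z′>0 ⟩}
      (weight-cong σ) (1/-cong {Z f H} {Z f′ H} Z>0 Z′>0 Z-cong))
    (List.filter A? (configs (order H)))

-- Terms of real list sums as rational sums over configurations

∑ᴸ : ∀ {A : Set} → (A → ℚ) → List A → ℚ
∑ᴸ g = List.foldr (λ a q → g a ℚ.+ q) 0ℚ

∑ᴸ-++ : ∀ {A : Set} (g : A → ℚ) as bs → ∑ᴸ g (as List.++ bs) ≡ ∑ᴸ g as ℚ.+ ∑ᴸ g bs
∑ᴸ-++ g []       bs = sym (ℚ.+-identityˡ (∑ᴸ g bs))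
∑ᴸ-++ g (a ∷ as) bs = trans (cong (g a ℚ.+_) (∑ᴸ-++ g as bs)) (sym (ℚ.+-assoc (g a) (∑ᴸ g as) (∑ᴸ g bs)))

∑ᴸ-map : ∀ {A B : Set} (g : B → ℚ) (h : A → B) as → ∑ᴸ g (List.map h as) ≡ ∑ᴸ (g ∘ h) as
∑ᴸ-map g h []       = refl
∑ᴸ-map g h (a ∷ as) = cong (g (h a) ℚ.+_) (∑ᴸ-map g h as)

∑ᴸ-configs : ∀ n (g : Config n → ℚ) → ∑ᴸ g (configs n) ≡ ∑ n g
∑ᴸ-configs zero    g = ℚ.+-identityʳ (g [])
∑ᴸ-configs (suc n) g = begin
  ∑ᴸ g (map (zero ∷_) cs List.++ map (suc zero ∷_) cs List.++ [])
    ≡⟨ ∑ᴸ-++ g (map (zero ∷_) cs) (map (suc zero ∷_) cs List.++ []) ⟩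
  ∑ᴸ g (map (zero ∷_) cs) ℚ.+ ∑ᴸ g (map (suc zero ∷_) cs List.++ [])
    ≡⟨ cong (∑ᴸ g (map (zero ∷_) cs) ℚ.+_) (trans (∑ᴸ-++ g (map (suc zero ∷_) cs) []) (ℚ.+-identityʳ _)) ⟩
  ∑ᴸ g (map (zero ∷_) cs) ℚ.+ ∑ᴸ g (map (suc zero ∷_) cs)
    ≡⟨ cong₂ ℚ._+_ (trans (∑ᴸ-map g (zero ∷_) cs) (∑ᴸ-configs n (g ∘ (zero ∷_))))
                  (trans (∑ᴸ-map g (suc zero ∷_) cs) (∑ᴸ-configs n (g ∘ (suc zero ∷_)))) ⟩
  ∑ (suc n) g ∎
  where
  open ≡-Reasoning
  map = List.map
  cs = configs n

seq-sum-configs : ∀ {n} (h : Config n → ℝ) i → seq (sum (List.map h (configs n))) i ≡ ∑ n (λ σ → seq (h σ) i)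
seq-sum-configs {n} h i = trans (go (configs n)) (∑ᴸ-configs n (λ σ → seq (h σ) i))
  where
  go : ∀ as → seq (sum (List.map h as)) i ≡ ∑ᴸ (λ σ → seq (h σ) i) as
  go []       = refl
  go (a ∷ as) = cong (seq (h a) i ℚ.+_) (go as)

filter-∷ : ∀ {X : Set} {A : Pred X 0ℓ} (A? : Decidable A) a as →
           List.filter A? (a ∷ as) ≡ (if does (A? a) then a ∷ List.filter A? as else List.filter A? as)
filter-∷ A? a as with does (A? a)
... | true  = refl
... | false = refl

seq-sum-filter : ∀ {n} (h : Config n → ℝ) {A : Pred (Config n) 0ℓ} (A? : Decidable A) i →
  seq (sum (List.map h (List.filter A? (configs n)))) i ≡ ∑ n (λ σ → if does (A? σ) then seq (h σ) i else 0ℚ)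
seq-sum-filter {n} h A? i = trans (go (configs n)) (∑ᴸ-configs n _)
  where
  branch : ∀ b a as → seq (sum (List.map h (if b then a ∷ as else as))) i ≡
                      (if b then seq (h a) i else 0ℚ) ℚ.+ seq (sum (List.map h as)) i
  branch true  a as = refl
  branch false a as = sym (ℚ.+-identityˡ (seq (sum (List.map h as)) i))
  go : ∀ as → seq (sum (List.map h (List.filter A? as))) i ≡
       ∑ᴸ (λ σ → if does (A? σ) then seq (h σ) i else 0ℚ) as
  go []       = refl
  go (a ∷ as) = trans (cong (λ l → seq (sum (List.map h l)) i) (filter-∷ A? a as))
    (trans (branch (does (A? a)) a (List.filter A? as))
        (cong ((if does (A? a) then seq (h a) i else 0ℚ) ℚ.+_) (go as)))

module _ (ω : ℕ → ℚ) (0≤ω : ∀ c → 0ℚ ℚ.≤ ω c) where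

  open Partition ω 0≤ω

  mass : ∀ {k n} → List (Hyperedge k n) → {A : Pred (Config n) 0ℓ} → Decidable A → ℚ
  mass es A? = ∑ _ (λ σ → if does (A? σ) then wt es σ else 0ℚ)

  -- Identifies the event in the definition of equality support with a diagonal entry of `pair`:
  -- deleting `u` renumbers `v` as `punchOut u≢v`, and only the half of the sum with spin `s` at `u`
  -- survives.
  mass-pair : ∀ {k m} (ds : List (Hyperedge k (suc m))) {u v} (u≢v : u ≢ v) s →
    mass ds (λ σ → all? (λ v → lookup σ v Fin.≟ s) (u ∷ v ∷ [])) ≡ Gadget.pair ds u (punchOut u≢v) s s
  mass-pair {m = m} ds {u} {v} u≢v s = trans (∑-insertAt m u A)
    (trans (cong₂ ℚ._+_ (∑-cong m (A≡B zero)) (∑-cong m (A≡B (suc zero)))) (root s refl))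
    where
    A : Config (suc m) → ℚ
    A σ = if does (all? (λ v → lookup σ v Fin.≟ s) (u ∷ v ∷ [])) then wt ds σ else 0ℚ
    leaf : Config m → Bool
    leaf τ = does (lookup τ (punchOut u≢v) Fin.≟ s)
    B : Spin → Config m → ℚ
    B a τ = if does (a Fin.≟ s) ∧ leaf τ ∧ true then wt ds (insertAt τ u a) else 0ℚ
    A≡B : ∀ a τ → A (insertAt τ u a) ≡ B a τ
    A≡B a τ = cong₂ (λ p q → if does (p Fin.≟ s) ∧ does (q Fin.≟ s) ∧ true then wt ds (insertAt τ u a) else 0ℚ)
      (Vec.insertAt-lookup τ u a)
      (trans (cong (lookup (insertAt τ u a)) (sym (Fin.punchIn-punchOut u≢v)))
             (Vec.insertAt-punchIn τ u a (punchOut u≢v)))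
    ∧-true : ∀ b {q} → (if b ∧ true then q else 0ℚ) ≡ (if b then q else 0ℚ)
    ∧-true true  = refl
    ∧-true false = refl
    -- Matching the equation makes `s` concrete inside `B`, where the test on the spin of `u` then
    -- computes.
    root : ∀ s′ → s ≡ s′ → ∑ m (B zero) ℚ.+ ∑ m (B (suc zero)) ≡ Gadget.pair ds u (punchOut u≢v) s s
    root zero       refl = trans (cong₂ ℚ._+_ (∑-cong m (λ τ → ∧-true (leaf τ))) (∑-0 m)) (ℚ.+-identityʳ _)
    root (suc zero) refl = trans (cong₂ ℚ._+_ (∑-0 m) (∑-cong m (λ τ → ∧-true (leaf τ)))) (ℚ.+-identityˡ _)

  mass-root : ∀ {k m} (es : List (Hyperedge k (suc m))) s →
              mass es (λ σ → lookup σ zero Fin.≟ s) ≡ rooted es zero s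
  mass-root {m = m} es zero       =
    trans (cong (rooted es zero zero ℚ.+_) (∑-0 m)) (ℚ.+-identityʳ (rooted es zero zero))
  mass-root {m = m} es (suc zero) =
    trans (cong (ℚ._+ rooted es zero (suc zero)) (∑-0 m)) (ℚ.+-identityˡ (rooted es zero (suc zero)))

  total-root : ∀ {k m} (es : List (Hyperedge k (suc m))) s →
               ∑ (suc m) (wt es) ≡ rooted es zero s ℚ.+ rooted es zero (opposite s)
  total-root es zero       = refl
  total-root es (suc zero) = ℚ.+-comm (rooted es zero zero) (rooted es zero (suc zero))

-- Real weights at a fixed index

-- Monotonicity in the bound lets the sum of the positive individual bounds serve for every index at
-- once.
all-eventually : ∀ n {P : Fin n → ℚ → ℕ → Set} → (∀ i {B B′ j} → B ℚ.≤ B′ → P i B j → P i B′ j) →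
  (∀ i → ∃[ B ] (0ℚ ℚ.< B × Eventually (P i B))) →
  ∃[ B ] (0ℚ ℚ.< B × Eventually λ j → ∀ i → P i B j)
all-eventually zero    mono h = 1ℚ , ℚ.positive⁻¹ 1ℚ , 0 , λ _ _ ()
all-eventually (suc n) {P} mono h =
  let (B , 0<B , p) = h zero
      (C , 0<C , q) = all-eventually n {P ∘ suc} (mono ∘ suc) (h ∘ suc)
  in B ℚ.+ C , 0<+ 0<B 0<C , mapᴱ (λ j (p , q) → λ
    { zero → mono zero (p≤p+q (ℚ.<⇒≤ 0<C)) p ; (suc i) → mono (suc i) (q≤p+q (ℚ.<⇒≤ 0<B)) (q i) }) (both p q)

-- ŵ is |w| on 0 … k; its values above k are junk.
module Weights {k : ℕ} (w : Fin (suc k) → ℝ) where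

  ŵ : ℕ → ℝ
  ŵ c = abs (w (c mod suc k))

  ω : ℕ → ℕ → ℚ
  ω i c = seq (ŵ c) i

  0≤ω : ∀ i c → 0ℚ ℚ.≤ ω i c
  0≤ω i c = ℚ.0≤∣p∣ (seq (w (c mod suc k)) i)

  ω-bounded : ∃[ B ] (0ℚ ℚ.< B × Eventually λ i → ∀ c → ω i c ℚ.≤ B)
  ω-bounded = let (B , 0<B , ev) = all-eventually (suc k) {λ ℓ B i → ℚ.∣ seq (w ℓ) i ∣ ℚ.≤ B}
                                     (λ _ B≤B′ p → ℚ.≤-trans p B≤B′) (λ ℓ → bounded {seq (w ℓ)} (cauchy (w ℓ)))
              in B , 0<B , mapᴱ (λ i h c → h (c mod suc k)) ev

  f̂ : Vec Spin k → ℝ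
  f̂ x = ŵ (count x)

  wt : ∀ i {n} → List (Hyperedge k n) → Config n → ℚ
  wt i = Partition.wt (ω i) (0≤ω i)

  massᵢ : ∀ i {n} → List (Hyperedge k n) → {A : Pred (Config n) 0ℓ} → Decidable A → ℚ
  massᵢ i = mass (ω i) (0≤ω i)

  totalᵢ : ∀ i {n} → List (Hyperedge k n) → ℚ
  totalᵢ i {n} es = ∑ n (wt i es)

  seq-weight : ∀ H σ i → seq (weight f̂ H σ) i ≡ wt i (edges H) σ
  seq-weight H σ i = go (edges H)
    where
    go : ∀ es → seq (product (List.map (λ e → f̂ (Vec.map (lookup σ) (endpoints e))) es)) i ≡ wt i es σ
    go []       = refl
    go (e ∷ es) = cong₂ ℚ._*_ (cong (ω i) (count-endpoints e σ)) (go es)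

  seq-Z : ∀ H i → seq (Z f̂ H) i ≡ totalᵢ i (edges H)
  seq-Z H i = trans (seq-sum-configs (weight f̂ H) i) (∑-cong (order H) (λ σ → seq-weight H σ i))

  seq-Pr : ∀ H Z>0 {A : Pred (Config (order H)) 0ℓ} (A? : Decidable A) i →
           seq (Pr f̂ H Z>0 A?) i ≡ massᵢ i (edges H) A? ℚ.* recip (totalᵢ i (edges H))
  seq-Pr H Z>0 A? i = trans (seq-sum-filter (μ f̂ H Z>0) A? i)
    (trans (∑-cong (order H) (λ σ → term (does (A? σ)) σ)) (∑-*ʳ (order H) (recip (totalᵢ i (edges H))) _))
    where
    term : ∀ b σ → (if b then seq (μ f̂ H Z>0 σ) i else 0ℚ) ≡
                   (if b then wt i (edges H) σ else 0ℚ) ℚ.* recip (totalᵢ i (edges H))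
    term true  σ = cong₂ (λ p q → p ℚ.* recip q) (seq-weight H σ i) (seq-Z H i)
    term false σ = sym (ℚ.*-zeroˡ (recip (totalᵢ i (edges H))))

  module _ (f : Vec Spin k → ℝ) (f≃f̂ : ∀ x → f x ≃ f̂ x) where

    -- A criterion free of division and of reals. The constant `c` bounds the total from below at
    -- all late indices, which is what strict positivity of `Z` means.
    pinning : ∀ s → (∀ d → 0ℚ ℚ.< d → Σ[ H ∈ Hypergraph k ] Σ[ v ∈ Vertex H ] ∃[ c ]
                (0ℚ ℚ.< c × Eventually λ i → c ℚ.≤ totalᵢ i (edges H) ×
                  (1ℚ ℚ.- d) ℚ.* totalᵢ i (edges H) ℚ.≤ massᵢ i (edges H) (λ σ → lookup σ v Fin.≟ s))) →
              SupportsPinning f s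
    pinning s h ε 0<ε = from (0<⇒seq {ε} 0<ε)
      where
      divide-≤ : ∀ {a b t} → 0ℚ ℚ.< t → a ℚ.* t ℚ.≤ b → a ℚ.≤ b ℚ.* recip t
      divide-≤ {a} {b} {t} 0<t h = ℚ.*-cancelʳ-≤-pos t {{ℚ.positive 0<t}} (subst (a ℚ.* t ℚ.≤_)
        (sym (trans (ℚ.*-assoc b (recip t) t)
            (trans (cong (b ℚ.*_) (recip-inverseˡ 0<t)) (ℚ.*-identityʳ b)))) h)
      assemble : ∀ {e d q τ} → d ℚ.≤ e → 0ℚ ℚ.< τ → 1ℚ ℚ.- d ℚ.≤ q → 1ℚ ℚ.- e ℚ.≤ q ℚ.+ τ
      assemble {e} {d} {q} {τ} d≤e 0<τ p = ℚ.≤-trans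
        (ℚ.≤-trans (ℚ.+-monoʳ-≤ 1ℚ (ℚ.neg-antimono-≤ d≤e)) p) (p≤p+q {q} {τ} (ℚ.<⇒≤ 0<τ))
      from : ∃[ d ] (0ℚ ℚ.< d × Eventually λ n → d ℚ.≤ seq ε n) →
             Σ[ H ∈ Hypergraph k ] Σ[ v ∈ Vertex H ] Σ[ Z>0 ∈ 0ℝ < Z f H ]
               Pr f H Z>0 (λ σ → lookup σ v Fin.≟ s) ≥ 1ℝ - ε
      from (d , 0<d , d≤ε) = build (h d 0<d)
        where
        build : Σ[ H ∈ Hypergraph k ] Σ[ v ∈ Vertex H ] ∃[ c ]
                  (0ℚ ℚ.< c × Eventually λ i → c ℚ.≤ totalᵢ i (edges H) ×
                    (1ℚ ℚ.- d) ℚ.* totalᵢ i (edges H) ℚ.≤ massᵢ i (edges H) (λ σ → lookup σ v Fin.≟ s)) →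
                Σ[ H ∈ Hypergraph k ] Σ[ v ∈ Vertex H ] Σ[ Z>0 ∈ 0ℝ < Z f H ]
                  Pr f H Z>0 (λ σ → lookup σ v Fin.≟ s) ≥ 1ℝ - ε
        build (H , v , c , 0<c , ev) = H , v , Z>0 ,
          ≥-resp-≃ {Pr f̂ H Ẑ>0 A?} {Pr f H Z>0 A?} {1ℝ - ε}
            (≃-sym {Pr f H Z>0 A?} {Pr f̂ H Ẑ>0 A?} (Pr-cong f f̂ f≃f̂ H Z>0 Ẑ>0 A?)) P̂r≥
          where
          A? : Decidable (λ σ → lookup σ v ≡ s)
          A? σ = lookup σ v Fin.≟ s
          Ẑ>0 : 0ℝ < Z f̂ H
          Ẑ>0 = seq⇒0< {Z f̂ H} 0<c (mapᴱ (λ i (c≤ , _) → subst (c ℚ.≤_) (sym (seq-Z H i)) c≤) ev)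
          Z>0 : 0ℝ < Z f H
          Z>0 = 0<-resp-≃ {Z f̂ H} {Z f H} (≃-sym {Z f H} {Z f̂ H} (Z-cong f f̂ f≃f̂ H)) Ẑ>0
          at : ∀ i → c ℚ.≤ totalᵢ i (edges H) → (1ℚ ℚ.- d) ℚ.* totalᵢ i (edges H) ℚ.≤ massᵢ i (edges H) A? →
               1ℚ ℚ.- d ℚ.≤ seq (Pr f̂ H Ẑ>0 A?) i
          at i c≤ ratio = subst (1ℚ ℚ.- d ℚ.≤_) (sym (seq-Pr H Ẑ>0 A? i)) (divide-≤ (ℚ.<-≤-trans 0<c c≤) ratio)
          P̂r≥ : Pr f̂ H Ẑ>0 A? ≥ 1ℝ - ε
          P̂r≥ τ 0<τ = mapᴱ (λ i ((c≤ , ratio) , d≤ε) →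
            assemble {seq ε i} {d} {seq (Pr f̂ H Ẑ>0 A?) i} {τ} d≤ε 0<τ (at i c≤ ratio)) (both ev d≤ε)

    -- The gadget is requested with accuracy `2 δ`, which gives `(1 - 2 δ) / 2 = ½ - δ`. Passing
    -- from `≥` on reals to late terms costs another `δ`.
    equality : SupportsEquality f 2 → ∀ δ → 0ℚ ℚ.< δ →
               Σ[ H ∈ Hypergraph k ] Σ[ u ∈ Vertex H ] Σ[ v ∈ Vertex H ] u ≢ v × ∃[ d ]
               (0ℚ ℚ.< d × Eventually λ i → d ℚ.≤ totalᵢ i (edges H) ×
                 (∀ s → (½ ℚ.- 2ℚ ℚ.* δ) ℚ.* totalᵢ i (edges H) ℚ.≤
                        massᵢ i (edges H) (λ σ → all? (λ v → lookup σ v Fin.≟ s) (u ∷ v ∷ []))))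
    equality eq δ 0<δ = from (eq (fromℚ (δ ℚ.+ δ))
        (seq⇒0< {fromℚ (δ ℚ.+ δ)} (0<+ 0<δ 0<δ) (0 , λ _ _ → ℚ.≤-refl)))
      where
      multiply-≤ : ∀ {a b t} → 0ℚ ℚ.< t → a ℚ.≤ b ℚ.* recip t → a ℚ.* t ℚ.≤ b
      multiply-≤ {a} {b} {t} 0<t h = subst (a ℚ.* t ℚ.≤_)
        (trans (ℚ.*-assoc b (recip t) t) (trans (cong (b ℚ.*_) (recip-inverseˡ 0<t)) (ℚ.*-identityʳ b)))
        (*-monoʳ (ℚ.<⇒≤ 0<t) h)
      drop : ∀ {p} → (1ℚ ℚ.- (δ ℚ.+ δ)) ℚ.* ½ ℚ.≤ p ℚ.+ δ → ½ ℚ.- 2ℚ ℚ.* δ ℚ.≤ p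
      drop {p} h = ≤-by (p ℚ.+ δ ℚ.- (1ℚ ℚ.- (δ ℚ.+ δ)) ℚ.* ½) (0≤- h) (identity p δ)
        where
        open +-*-Solver
        identity : ∀ p δ → p ≡ (½ ℚ.- 2ℚ ℚ.* δ) ℚ.+ (p ℚ.+ δ ℚ.- (1ℚ ℚ.- (δ ℚ.+ δ)) ℚ.* ½)
        identity = solve 2 (λ p δ →
          p := (con ½ :- con 2ℚ :* δ) :+ (p :+ δ :- (con 1ℚ :- (δ :+ δ)) :* con ½)) refl
      from : Σ[ H ∈ Hypergraph k ] Σ[ vs ∈ Vec (Vertex H) 2 ] Σ[ Z>0 ∈ 0ℝ < Z f H ]
             (Distinct.Unique vs ×
               (∀ s → Pr f H Z>0 (λ σ → all? (λ v → lookup σ v Fin.≟ s) vs) ≥ (1ℝ - fromℚ (δ ℚ.+ δ)) * ½ℝ)) → _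
      from (H , vs@(u ∷ v ∷ []) , Z>0 , ((u≢v VecAll.∷ _) VecAllPairs.∷ _) , pr) =
        H , u , v , u≢v , proj₁ pos , proj₁ (proj₂ pos) ,
        mapᴱ (λ i (d≤ , p₀ , p₁) → let d≤t = subst (proj₁ pos ℚ.≤_) (seq-Z H i) d≤ in
          d≤t , λ { zero → bound i zero d≤t p₀ ; (suc zero) → bound i (suc zero) d≤t p₁ })
          (both (proj₂ (proj₂ pos)) (both (pr̂ zero δ 0<δ) (pr̂ (suc zero) δ 0<δ)))
        where
        A? : ∀ s → Decidable (λ σ → VecAll.All (λ v → lookup σ v ≡ s) vs)
        A? s σ = all? (λ v → lookup σ v Fin.≟ s) vs
        Ẑ>0 : 0ℝ < Z f̂ H
        Ẑ>0 = 0<-resp-≃ {Z f H} {Z f̂ H} (Z-cong f f̂ f≃f̂ H) Z>0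
        pos : ∃[ d ] (0ℚ ℚ.< d × Eventually λ i → d ℚ.≤ seq (Z f̂ H) i)
        pos = 0<⇒seq {Z f̂ H} Ẑ>0
        pr̂ : ∀ s → Pr f̂ H Ẑ>0 (A? s) ≥ (1ℝ - fromℚ (δ ℚ.+ δ)) * ½ℝ
        pr̂ s = ≥-resp-≃ {Pr f H Z>0 (A? s)} {Pr f̂ H Ẑ>0 (A? s)} {(1ℝ - fromℚ (δ ℚ.+ δ)) * ½ℝ}
          (Pr-cong f f̂ f≃f̂ H Z>0 Ẑ>0 (A? s)) (pr s)
        bound : ∀ i s → proj₁ pos ℚ.≤ totalᵢ i (edges H) →
                (1ℚ ℚ.- (δ ℚ.+ δ)) ℚ.* ½ ℚ.≤ seq (Pr f̂ H Ẑ>0 (A? s)) i ℚ.+ δ →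
                (½ ℚ.- 2ℚ ℚ.* δ) ℚ.* totalᵢ i (edges H) ℚ.≤ massᵢ i (edges H) (A? s)
        bound i s d≤t h = multiply-≤ (ℚ.<-≤-trans (proj₁ (proj₂ pos)) d≤t)
          (subst (½ ℚ.- 2ℚ ℚ.* δ ℚ.≤_) (seq-Pr H Ẑ>0 (A? s) i) (drop h))

-- Amplification

0≤slack : ∀ n → 0ℚ ℚ.≤ slack n
0≤slack zero    = ℚ.≤-refl
0≤slack (suc n) = 0≤+ (ℚ.nonNegative⁻¹ 2ℚ) (0≤* (ℚ.nonNegative⁻¹ 2ℚ) (0≤slack n))

-- The ratio `κ / δ`. The gadget yields `h = (½ - 2 δ) t` for its total `t`, and `t ≤ (2 + κ) h`
-- requires `(2 + κ)(½ - 2 δ) ≥ 1`. To first order the left side is `1 + κ / 2 - 4 δ`, so the ratio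
-- has to exceed 8; with 12 it equals `1 + 2 δ (1 - κ)`.
12ℚ : ℚ
12ℚ = + 12 ℚ./ 1

module _ {k : ℕ} (2≤k : 2 ℕ.≤ k) (w : Fin (suc k) → ℝ) (f : Vec Spin k → ℝ) where

  open Weights w

  module _ (f≃f̂ : ∀ x → f x ≃ f̂ x) (eq₂ : SupportsEquality f 2) where

    -- The gap `e` and the bound `B` fix `κ` and `θ`, and `κ` fixes the gadget through `δ`. The
    -- gadget does not depend on the pinning accuracy, which only the number of copies has to meet.
    biased⇒pinning : ∀ s ts → List.length ts ≡ k → ∀ e → 0ℚ ℚ.< e →
      Eventually (λ i → bias (ω i) ts (opposite s) ℚ.+ 2ℚ ℚ.* e ℚ.≤ bias (ω i) ts s) → SupportsPinning f s
    biased⇒pinning s ts len e 0<e gap = fromGadget (equality f f≃f̂ eq₂ δ 0<δ)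
      where
      n = List.length ts
      S = slack n
      B = proj₁ ω-bounded
      0<B = proj₁ (proj₂ ω-bounded)
      0<2 : 0ℚ ℚ.< 2ℚ
      0<2 = ℚ.positive⁻¹ 2ℚ
      0≤SB : 0ℚ ℚ.≤ 2ℚ ℚ.* (S ℚ.* B)
      0≤SB = 0≤* (ℚ.<⇒≤ 0<2) (0≤* (0≤slack n) (ℚ.<⇒≤ 0<B))
      -- Dropping one or the other summand of `κ (2 S B + 2 e) = e` gives the two requirements on
      -- `κ`: the error is at most `e`, and `2 κ ≤ 1`.
      κ-spec = divide {e} {2ℚ ℚ.* (S ℚ.* B) ℚ.+ 2ℚ ℚ.* e} 0<e (ℚ.+-mono-≤-< 0≤SB (0<* 0<2 0<e))
      κ = proj₁ κ-spec
      0<κ = proj₁ (proj₂ κ-spec)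
      δ-spec = divide {κ} {12ℚ} 0<κ (ℚ.positive⁻¹ 12ℚ)
      δ = proj₁ δ-spec
      0<δ = proj₁ (proj₂ δ-spec)
      θ-spec = divide {e} {2ℚ ℚ.* B} 0<e (0<* 0<2 0<B)
      θ = proj₁ θ-spec
      0<θ = proj₁ (proj₂ θ-spec)
      ρ = ½ ℚ.- 2ℚ ℚ.* δ

      error≤e : 2ℚ ℚ.* (S ℚ.* κ ℚ.* B) ℚ.≤ e
      error≤e = ≤-by (κ ℚ.* (2ℚ ℚ.* e)) (0≤* (ℚ.<⇒≤ 0<κ) (0≤* (ℚ.<⇒≤ 0<2) (ℚ.<⇒≤ 0<e)))
        (trans (sym (proj₂ (proj₂ κ-spec))) (identity κ S B e))
        where
        open +-*-Solver
        identity : ∀ κ S B e → κ ℚ.* (2ℚ ℚ.* (S ℚ.* B) ℚ.+ 2ℚ ℚ.* e) ≡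
                   2ℚ ℚ.* (S ℚ.* κ ℚ.* B) ℚ.+ κ ℚ.* (2ℚ ℚ.* e)
        identity = solve 4 (λ κ S B e → κ :* (con 2ℚ :* (S :* B) :+ con 2ℚ :* e) :=
                   con 2ℚ :* (S :* κ :* B) :+ κ :* (con 2ℚ :* e)) refl

      2κ≤1 : 2ℚ ℚ.* κ ℚ.≤ 1ℚ
      2κ≤1 = ℚ.*-cancelʳ-≤-pos e {{ℚ.positive 0<e}} (≤-by (κ ℚ.* (2ℚ ℚ.* (S ℚ.* B)))
        (0≤* (ℚ.<⇒≤ 0<κ) 0≤SB)
        (trans (ℚ.*-identityˡ e) (trans (sym (proj₂ (proj₂ κ-spec))) (identity κ (2ℚ ℚ.* (S ℚ.* B)) e))))
        where
        open +-*-Solver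
        identity : ∀ κ x e → κ ℚ.* (x ℚ.+ 2ℚ ℚ.* e) ≡ 2ℚ ℚ.* κ ℚ.* e ℚ.+ κ ℚ.* x
        identity = solve 3 (λ κ x e → κ :* (x :+ con 2ℚ :* e) := con 2ℚ :* κ :* e :+ κ :* x) refl

      0<ρ : 0ℚ ℚ.< ρ
      0<ρ = subst (0ℚ ℚ.<_) (sym (identity δ)) (ℚ.+-mono-≤-<
        (0≤* (ℚ.nonNegative⁻¹ ½) (0≤- (subst (λ x → 2ℚ ℚ.* x ℚ.≤ 1ℚ) (sym (proj₂ (proj₂ δ-spec))) 2κ≤1)))
        (0<* (ℚ.positive⁻¹ (12ℚ ℚ.- 2ℚ)) 0<δ))
        where
        open +-*-Solver
        identity : ∀ δ → ½ ℚ.- 2ℚ ℚ.* δ ≡ ½ ℚ.* (1ℚ ℚ.- 2ℚ ℚ.* (δ ℚ.* 12ℚ)) ℚ.+ (12ℚ ℚ.- 2ℚ) ℚ.* δ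
        identity = solve 1 (λ δ → con ½ :- con 2ℚ :* δ :=
          con ½ :* (con 1ℚ :- con 2ℚ :* (δ :* con 12ℚ)) :+ (con 12ℚ :- con 2ℚ) :* δ) refl

      total≤ : ∀ t → 0ℚ ℚ.≤ t → t ℚ.≤ (2ℚ ℚ.+ κ) ℚ.* (ρ ℚ.* t)
      total≤ t 0≤t = ≤-by (2ℚ ℚ.* δ ℚ.* ((1ℚ ℚ.- 2ℚ ℚ.* κ) ℚ.+ κ) ℚ.* t)
        (0≤* (0≤* (0≤* (ℚ.<⇒≤ 0<2) (ℚ.<⇒≤ 0<δ)) (0≤+ (0≤- 2κ≤1) (ℚ.<⇒≤ 0<κ))) 0≤t)
        (subst (λ κ → (2ℚ ℚ.+ κ) ℚ.* (ρ ℚ.* t) ≡ t ℚ.+ 2ℚ ℚ.* δ ℚ.* ((1ℚ ℚ.- 2ℚ ℚ.* κ) ℚ.+ κ) ℚ.* t)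
          (proj₂ (proj₂ δ-spec)) (identity δ t))
        where
        open +-*-Solver
        identity : ∀ δ t → (2ℚ ℚ.+ δ ℚ.* 12ℚ) ℚ.* ((½ ℚ.- 2ℚ ℚ.* δ) ℚ.* t) ≡
          t ℚ.+ 2ℚ ℚ.* δ ℚ.* ((1ℚ ℚ.- 2ℚ ℚ.* (δ ℚ.* 12ℚ)) ℚ.+ δ ℚ.* 12ℚ) ℚ.* t
        identity = solve 2 (λ δ t → (con 2ℚ :+ δ :* con 12ℚ) :* ((con ½ :- con 2ℚ :* δ) :* t) :=
          t :+ con 2ℚ :* δ :* ((con 1ℚ :- con 2ℚ :* (δ :* con 12ℚ)) :+ δ :* con 12ℚ) :* t) refl

      fromGadget : Σ[ H ∈ Hypergraph k ] Σ[ u ∈ Vertex H ] Σ[ v ∈ Vertex H ] u ≢ v × ∃[ d ]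
                   (0ℚ ℚ.< d × Eventually λ i → d ℚ.≤ totalᵢ i (edges H) ×
                     (∀ s → ρ ℚ.* totalᵢ i (edges H) ℚ.≤
                            massᵢ i (edges H) (λ σ → all? (λ v → lookup σ v Fin.≟ s) (u ∷ v ∷ [])))) →
                   SupportsPinning f s
      fromGadget (record { order = zero } , () , _)
      fromGadget (record { order = suc m ; edges = ds ; distinct = uds } , u , v , u≢v , d , 0<d , ev) =
        pinning f f≃f̂ s pin
        where
        leaf = punchOut u≢v
        module St = Star ds u leaf
        center : List (Hyperedge k (2 ℕ.+ St.size ts))
        center = St.closed ts len
        module Bq = Bouquet center
        pin : ∀ d′ → 0ℚ ℚ.< d′ → Σ[ H ∈ Hypergraph k ] Σ[ v ∈ Vertex H ] ∃[ c ]
                (0ℚ ℚ.< c × Eventually λ i → c ℚ.≤ totalᵢ i (edges H) ×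
                  (1ℚ ℚ.- d′) ℚ.* totalᵢ i (edges H) ℚ.≤ massᵢ i (edges H) (λ σ → lookup σ v Fin.≟ s))
        pin d′ 0<d′ = H , zero , c , 0<c , mapᴱ (λ i (ev , ω≤B , gap) → at i ev ω≤B gap)
            (both ev (both (proj₂ (proj₂ ω-bounded)) gap))
          where
          -- Odds of at least `1 + M θ` leave the other spin a probability of at most
          -- `1 / (2 + M θ)`, which is below `d′` as soon as `d′ M θ ≥ 1`.
          M-spec = archimedean (0<* 0<d′ 0<θ)
          M = proj₁ M-spec
          H : Hypergraph k
          H = record { order    = suc (Bq.size M)
                     ; edges    = Bq.bouquet M
                     ; distinct = Bq.bouquet-unique 2≤k (St.closed-unique 2≤k uds ts len) M }
          -- The bound of `bouquet≥` with the gadget's total, which varies with the index, replaced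
          -- by its fixed lower bound `d`.
          c = ((ρ ℚ.* d) ^ n ℚ.* (2ℚ ℚ.* e)) ^ M
          0<c : 0ℚ ℚ.< c
          0<c = 0<^ (0<* (0<^ (0<* 0<ρ 0<d) n) (0<* 0<2 0<e)) M
          ·-assoc : ∀ n p q → n · (p ℚ.* q) ≡ p ℚ.* n · q
          ·-assoc zero    p q = sym (ℚ.*-zeroʳ p)
          ·-assoc (suc n) p q = trans (cong (p ℚ.* q ℚ.+_) (·-assoc n p q)) (sym (ℚ.*-distribˡ-+ p q (n · q)))
          1≤d′Mθ : 1ℚ ℚ.≤ d′ ℚ.* M · θ
          1≤d′Mθ = subst (1ℚ ℚ.≤_) (·-assoc M d′ θ) (proj₂ M-spec)
          ratio : ∀ x y → 0ℚ ℚ.≤ y → (1ℚ ℚ.+ M · θ) ℚ.* y ℚ.≤ x → (1ℚ ℚ.- d′) ℚ.* (x ℚ.+ y) ℚ.≤ x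
          ratio x y 0≤y h = ≤-by
            (d′ ℚ.* (x ℚ.- (1ℚ ℚ.+ M · θ) ℚ.* y) ℚ.+ (d′ ℚ.* M · θ ℚ.- 1ℚ) ℚ.* y ℚ.+ 2ℚ ℚ.* d′ ℚ.* y)
            (0≤+ (0≤+ (0≤* (ℚ.<⇒≤ 0<d′) (0≤- h)) (0≤* (0≤- 1≤d′Mθ) 0≤y))
                 (0≤* (0≤* (ℚ.<⇒≤ 0<2) (ℚ.<⇒≤ 0<d′)) 0≤y))
            (identity d′ (M · θ) x y)
            where
            open +-*-Solver
            identity : ∀ d r x y → x ≡ (1ℚ ℚ.- d) ℚ.* (x ℚ.+ y) ℚ.+
              (d ℚ.* (x ℚ.- (1ℚ ℚ.+ r) ℚ.* y) ℚ.+ (d ℚ.* r ℚ.- 1ℚ) ℚ.* y ℚ.+ 2ℚ ℚ.* d ℚ.* y)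
            identity = solve 4 (λ d r x y → x := (con 1ℚ :- d) :* (x :+ y) :+
              (d :* (x :- (con 1ℚ :+ r) :* y) :+ (d :* r :- con 1ℚ) :* y :+ con 2ℚ :* d :* y)) refl
          at : ∀ i →
               (d ℚ.≤ totalᵢ i ds × (∀ s → ρ ℚ.* totalᵢ i ds ℚ.≤
                  massᵢ i ds (λ σ → all? (λ v → lookup σ v Fin.≟ s) (u ∷ v ∷ [])))) →
               (∀ c → ω i c ℚ.≤ B) →
               bias (ω i) ts (opposite s) ℚ.+ 2ℚ ℚ.* e ℚ.≤ bias (ω i) ts s →
               c ℚ.≤ totalᵢ i (edges H) ×
               (1ℚ ℚ.- d′) ℚ.* totalᵢ i (edges H) ℚ.≤ massᵢ i (edges H) (λ σ → lookup σ zero Fin.≟ s)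
          at i (d≤ , diagonal) ω≤B gap =
            subst (c ℚ.≤_) (sym (total-root (ω i) (0≤ω i) (Bq.bouquet M) s))
              (ℚ.≤-trans c≤ (p≤p+q {X} 0≤Y)) ,
            subst₂ (λ t x → (1ℚ ℚ.- d′) ℚ.* t ℚ.≤ x)
              (sym (total-root (ω i) (0≤ω i) (Bq.bouquet M) s))
              (sym (mass-root (ω i) (0≤ω i) (Bq.bouquet M) s))
              (ratio X Y 0≤Y (Bd.bouquet-gap ω≤B ts len s (ℚ.<⇒≤ 0<e) (ℚ.<⇒≤ 0<θ) error≤e θ-small gap M))
            where
            T = totalᵢ i ds
            0≤T : 0ℚ ℚ.≤ T
            0≤T = ℚ.≤-trans (ℚ.<⇒≤ 0<d) d≤
            module Pt = Partition (ω i) (0≤ω i)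
            module Bd = Pt.Gadget.Bounds ds u leaf (ρ ℚ.* T) κ (0≤* (ℚ.<⇒≤ 0<ρ) 0≤T) (ℚ.<⇒≤ 0<κ) 2κ≤1
              (λ s → subst (ρ ℚ.* T ℚ.≤_) (mass-pair (ω i) (0≤ω i) ds u≢v s) (diagonal s))
              (total≤ T 0≤T)
            X = Pt.rooted (Bq.bouquet M) zero s
            Y = Pt.rooted (Bq.bouquet M) zero (opposite s)
            0≤Y : 0ℚ ℚ.≤ Y
            0≤Y = Pt.0≤rooted (Bq.bouquet M) zero (opposite s)
            θ-small : θ ℚ.* (2ℚ ℚ.* B) ℚ.≤ e
            θ-small = ℚ.≤-reflexive (proj₂ (proj₂ θ-spec))
            0≤ρd : 0ℚ ℚ.≤ ρ ℚ.* d
            0≤ρd = 0≤* (ℚ.<⇒≤ 0<ρ) (ℚ.<⇒≤ 0<d)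
            0≤2e : 0ℚ ℚ.≤ 2ℚ ℚ.* e
            0≤2e = 0≤* (ℚ.<⇒≤ 0<2) (ℚ.<⇒≤ 0<e)
            c≤ : c ℚ.≤ X
            c≤ = ℚ.≤-trans
              (^-mono (0≤* (0≤^ 0≤ρd n) 0≤2e)
                (*-monoʳ 0≤2e (^-mono 0≤ρd (*-monoˡ (ℚ.<⇒≤ 0<ρ) d≤) n)) M)
              (Bd.bouquet≥ ω≤B ts len s (ℚ.<⇒≤ 0<e) (ℚ.<⇒≤ 0<θ) error≤e θ-small gap M)

-- Comparing one late term of x - y with a threshold decides which of the
-- three alternatives to take.
no-gap⇒≃ : ∀ {x y : ℝ} →
  (∀ e → 0ℚ ℚ.< e → ¬ Eventually (λ i → seq x i ℚ.+ 2ℚ ℚ.* e ℚ.≤ seq y i)) →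
  (∀ e → 0ℚ ℚ.< e → ¬ Eventually (λ i → seq y i ℚ.+ 2ℚ ℚ.* e ℚ.≤ seq x i)) → x ≃ y
no-gap⇒≃ {x} {y} x≮y y≮x ε 0<ε = from (cauchy (x - y) e 0<e)
  where
  4ℚ = 2ℚ ℚ.+ 2ℚ
  -- Terms vary by at most `e` from `N` on. A difference of at least `3 e` at `N` thus stays at
  -- least `2 e`, the excluded gap, and one of at most `3 e` stays within `4 e = ε`.
  e-spec = divide 0<ε (ℚ.positive⁻¹ 4ℚ)
  e = proj₁ e-spec
  0<e = proj₁ (proj₂ e-spec)
  3e = (2ℚ ℚ.+ 1ℚ) ℚ.* e
  open +-*-Solver
  far : ∀ {a b z} → 3e ℚ.≤ z → z ℚ.≤ (a ℚ.- b) ℚ.+ e → b ℚ.+ 2ℚ ℚ.* e ℚ.≤ a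
  far {a} {b} {z} p q = ≤-by ((((a ℚ.- b) ℚ.+ e) ℚ.- z) ℚ.+ (z ℚ.- 3e)) (0≤+ (0≤- q) (0≤- p)) (identity a b z e)
    where
    identity : ∀ a b z e → a ≡ (b ℚ.+ 2ℚ ℚ.* e) ℚ.+ ((((a ℚ.- b) ℚ.+ e) ℚ.- z) ℚ.+ (z ℚ.- (2ℚ ℚ.+ 1ℚ) ℚ.* e))
    identity = solve 4 (λ a b z e → a :=
      (b :+ con 2ℚ :* e) :+ ((((a :- b) :+ e) :- z) :+ (z :- (con 2ℚ :+ con 1ℚ) :* e))) refl
  near : ∀ {d z} → z ℚ.≤ 3e → d ℚ.≤ z ℚ.+ e → d ℚ.≤ ε
  near {d} {z} p q = ℚ.≤-trans q (ℚ.≤-trans (ℚ.+-monoˡ-≤ e p)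
    (ℚ.≤-reflexive (trans (identity e) (proj₂ (proj₂ e-spec)))))
    where
    identity : ∀ e → (2ℚ ℚ.+ 1ℚ) ℚ.* e ℚ.+ e ≡ e ℚ.* (2ℚ ℚ.+ 2ℚ)
    identity = solve 1 (λ e → (con 2ℚ :+ con 1ℚ) :* e :+ e := e :* (con 2ℚ :+ con 2ℚ)) refl
  negate : ∀ a b → ℚ.- (a ℚ.- b) ≡ b ℚ.- a
  negate = solve 2 (λ a b → :- (a :- b) := b :- a) refl
  Close : ℕ → ℕ → Set
  Close i j = seq (x - y) i ℚ.≤ seq (x - y) j ℚ.+ e × seq (y - x) i ℚ.≤ seq (y - x) j ℚ.+ e
  from : ∃[ N ] (∀ m n → N ℕ.≤ m → N ℕ.≤ n → ℚ.∣ seq (x - y) m ℚ.- seq (x - y) n ∣ ℚ.≤ e) →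
         Eventually (λ i → ℚ.∣ seq x i ℚ.- seq y i ∣ ℚ.≤ ε)
  from (N , h) = cases (ℚ.≤-total 3e (seq (x - y) N)) (ℚ.≤-total 3e (seq (y - x) N))
    where
    close : ∀ i j → N ℕ.≤ i → N ℕ.≤ j → Close i j
    close i j ≤i ≤j = ∣p-q∣≤⇒p≤q+ {seq (x - y) i} (h i j ≤i ≤j) ,
      subst₂ (λ p q → p ℚ.≤ q ℚ.+ e) (negate (seq x i) (seq y i)) (negate (seq x j) (seq y j))
        (reflect {seq (x - y) i} {seq (x - y) j} (∣p-q∣≤⇒p≤q+ {seq (x - y) j} (h j i ≤j ≤i)))
      where
      reflect : ∀ {p q} → q ℚ.≤ p ℚ.+ e → ℚ.- p ℚ.≤ ℚ.- q ℚ.+ e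
      reflect {p} {q} le = ≤-by (p ℚ.+ e ℚ.- q) (0≤- le) (identity p q e)
        where
        identity : ∀ p q e → ℚ.- q ℚ.+ e ≡ ℚ.- p ℚ.+ (p ℚ.+ e ℚ.- q)
        identity = solve 3 (λ p q e → :- q :+ e := :- p :+ (p :+ e :- q)) refl
    cases : 3e ℚ.≤ seq (x - y) N ⊎ seq (x - y) N ℚ.≤ 3e →
            3e ℚ.≤ seq (y - x) N ⊎ seq (y - x) N ℚ.≤ 3e →
            Eventually (λ i → ℚ.∣ seq x i ℚ.- seq y i ∣ ℚ.≤ ε)
    cases (inj₁ p) _ = contradiction
      (N , λ i ≤i → far {seq x i} {seq y i} {seq (x - y) N} p (proj₁ (close N i ℕ.≤-refl ≤i))) (y≮x e 0<e)
    cases _ (inj₁ q) = contradiction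
      (N , λ i ≤i → far {seq y i} {seq x i} {seq (y - x) N} q (proj₂ (close N i ℕ.≤-refl ≤i))) (x≮y e 0<e)
    cases (inj₂ p) (inj₂ q) = N , λ i ≤i → ∣p∣≤ {seq (x - y) i}
      (near {seq (x - y) i} {seq (x - y) N} p (proj₁ (close i N ≤i ℕ.≤-refl)))
      (subst (ℚ._≤ ε) (sym (negate (seq x i) (seq y i)))
        (near {seq (y - x) i} {seq (y - x) N} q (proj₂ (close i N ≤i ℕ.≤-refl))))

+-cancelʳ : ∀ {x y z : ℝ} → x + z ≃ y + z → x ≃ y
+-cancelʳ {x} {y} {z} eq ε 0<ε =
  mapᴱ (λ i → subst (λ p → ℚ.∣ p ∣ ℚ.≤ ε) (cancel (seq x i) (seq y i) (seq z i))) (eq ε 0<ε)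
  where
  open +-*-Solver
  cancel : ∀ a b c → (a ℚ.+ c) ℚ.- (b ℚ.+ c) ≡ a ℚ.- b
  cancel = solve 3 (λ a b c → (a :+ c) :- (b :+ c) := a :- b) refl

double-injective : ∀ {x y : ℝ} → x + x ≃ y + y → x ≃ y
double-injective {x} {y} eq =
  ≃-trans {x} {½ℝ * (x + x)} {y} (≗⇒≃ {x} {½ℝ * (x + x)} (λ i → halve (seq x i)))
    (≃-trans {½ℝ * (x + x)} {½ℝ * (y + y)} {y}
      (*-cong {½ℝ} {½ℝ} {x + x} {y + y} (≃-refl {½ℝ}) eq)
      (≗⇒≃ {½ℝ * (y + y)} {y} (λ i → sym (halve (seq y i)))))
  where
  open +-*-Solver
  halve : ∀ a → a ≡ ½ ℚ.* (a ℚ.+ a)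
  halve = solve 1 (λ a → a := con ½ :* (a :+ a)) refl

-- Stars with two blocks of leaves, and the symmetry of the weights

blocks : ℕ → ℕ → List (Fin 2)
blocks n j = List.replicate n zero List.++ List.replicate j (suc zero)

length-blocks : ∀ n j → List.length (blocks n j) ≡ n ℕ.+ j
length-blocks n j = trans (List.length-++ (List.replicate n zero))
  (cong₂ ℕ._+_ (List.length-replicate n) (List.length-replicate j))

level-blocks : ∀ n j a b → level (a ∷ b ∷ []) (blocks n j) ≡ n ℕ.* toℕ a ℕ.+ j ℕ.* toℕ b
level-blocks zero    zero    a b = refl
level-blocks zero    (suc j) a b = trans (cong (ℕ._+ toℕ b) (level-blocks zero j a b))
  (ℕ.+-comm (j ℕ.* toℕ b) (toℕ b))
level-blocks (suc n) j       a b = trans (cong (ℕ._+ toℕ a) (level-blocks n j a b))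
  (trans (ℕ.+-comm (n ℕ.* toℕ a ℕ.+ j ℕ.* toℕ b) (toℕ a)) (sym (ℕ.+-assoc (toℕ a) (n ℕ.* toℕ a) (j ℕ.* toℕ b))))

lemma14 : (k : ℕ) → 2 ℕ.≤ k →
    (f : Vec Spin k → ℝ) → (∀ x → 0ℝ ≤ f x) → Symmetric f →
    (w : Fin (ℕ.suc k) → ℝ) → (∀ ℓ → 0ℝ ≤ w ℓ) →
    (∀ x ℓ → Vec.sum (Vec.map toℕ x) ≡ toℕ ℓ → f x ≃ w ℓ) →
    SupportsEquality f 2 →
    ¬ SupportsPinning f zero → ¬ SupportsPinning f (suc zero) →
    ∀ ℓ → w ℓ ≃ w (opposite ℓ)
lemma14 k 2≤k f _ _ w 0≤w f≃w eq₂ ¬pin₀ ¬pin₁ ℓ =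
  ≃-trans {w ℓ} {ŵ n} {w (opposite ℓ)} (w≃ŵ ℓ)
    (≃-trans {ŵ n} {ŵ (k ℕ.∸ n)} {w (opposite ℓ)}
      -- In the balance at `n`, replacing `ŵ k` by `ŵ 0` puts the same summand on both sides, which
      -- then cancels.
      (≃-sym {ŵ (k ℕ.∸ n)} {ŵ n} (+-cancelʳ {ŵ (k ℕ.∸ n)} {ŵ n} {ŵ 0}
        (≃-trans {ŵ (k ℕ.∸ n) + ŵ 0} {ŵ n + ŵ k} {ŵ n + ŵ 0}
          (≃-trans {ŵ (k ℕ.∸ n) + ŵ 0} {ŵ 0 + ŵ (k ℕ.∸ n)} {ŵ n + ŵ k}
            (≗⇒≃ {ŵ (k ℕ.∸ n) + ŵ 0} {ŵ 0 + ŵ (k ℕ.∸ n)} (λ i → ℚ.+-comm (ω i (k ℕ.∸ n)) (ω i 0)))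
            (balance n (Fin.toℕ≤pred[n] ℓ)))
          (+-cong {ŵ n} {ŵ n} {ŵ k} {ŵ 0} (≃-refl {ŵ n}) (≃-sym {ŵ 0} {ŵ k} ŵ0≃ŵk)))))
      (subst (λ j → ŵ j ≃ w (opposite ℓ)) (Fin.opposite-prop ℓ)
        (≃-sym {w (opposite ℓ)} {ŵ (toℕ (opposite ℓ))} (w≃ŵ (opposite ℓ)))))
  where
  open Weights w
  n = toℕ ℓ

  mod-toℕ : ∀ c (ℓ : Fin (suc k)) → c ≡ toℕ ℓ → c mod suc k ≡ ℓ
  mod-toℕ c ℓ refl = Fin.toℕ-injective
    (trans (Fin.toℕ-fromℕ< (m%n<n c (suc k))) (m<n⇒m%n≡m (Fin.toℕ<n ℓ)))

  w≃ŵ : ∀ ℓ → w ℓ ≃ ŵ (toℕ ℓ)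
  w≃ŵ ℓ = subst (λ ℓ′ → w ℓ ≃ abs (w ℓ′)) (sym (mod-toℕ (toℕ ℓ) ℓ refl)) (0≤⇒≃abs {w ℓ} (0≤w ℓ))

  f≃f̂ : ∀ x → f x ≃ f̂ x
  f≃f̂ x = ≃-trans {f x} {w c} {f̂ x}
    (f≃w x c (sym (trans (Fin.toℕ-fromℕ< (m%n<n (count x) (suc k))) (m<n⇒m%n≡m (ℕ.s≤s (count≤ x))))))
    (0≤⇒≃abs {w c} (0≤w c))
    where c = count x mod suc k

  ¬pin : ∀ s → ¬ SupportsPinning f s
  ¬pin zero       = ¬pin₀
  ¬pin (suc zero) = ¬pin₁

  biasℝ : List (Fin 2) → Spin → ℝ
  biasℝ ts a = ŵ (level (a ∷ zero ∷ []) ts) + ŵ (level (a ∷ suc zero ∷ []) ts)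

  unbiased : ∀ ts → List.length ts ≡ k → biasℝ ts zero ≃ biasℝ ts (suc zero)
  unbiased ts len = no-gap⇒≃ {biasℝ ts zero} {biasℝ ts (suc zero)}
    (λ e 0<e gap → ¬pin (suc zero) (biased⇒pinning 2≤k w f f≃f̂ eq₂ (suc zero) ts len e 0<e gap))
    (λ e 0<e gap → ¬pin zero (biased⇒pinning 2≤k w f f≃f̂ eq₂ zero ts len e 0<e gap))

  balance : ∀ n → n ℕ.≤ k → ŵ 0 + ŵ (k ℕ.∸ n) ≃ ŵ n + ŵ k
  balance n n≤k = subst₂ _≃_
    (cong₂ (λ c d → ŵ c + ŵ d)
      (trans (level-blocks n j zero zero) (cong₂ ℕ._+_ (ℕ.*-zeroʳ n) (ℕ.*-zeroʳ j)))
      (trans (level-blocks n j zero (suc zero)) (cong₂ ℕ._+_ (ℕ.*-zeroʳ n) (ℕ.*-identityʳ j))))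
    (cong₂ (λ c d → ŵ c + ŵ d)
      (trans (level-blocks n j (suc zero) zero)
          (trans (cong₂ ℕ._+_ (ℕ.*-identityʳ n) (ℕ.*-zeroʳ j)) (ℕ.+-identityʳ n)))
      (trans (level-blocks n j (suc zero) (suc zero))
          (trans (cong₂ ℕ._+_ (ℕ.*-identityʳ n) (ℕ.*-identityʳ j)) n+j≡k)))
    (unbiased (blocks n j) (trans (length-blocks n j) n+j≡k))
    where
    j = k ℕ.∸ n
    n+j≡k : n ℕ.+ j ≡ k
    n+j≡k = ℕ.m+[n∸m]≡n n≤k

  ŵ0≃ŵk : ŵ 0 ≃ ŵ k
  ŵ0≃ŵk = double-injective {ŵ 0} {ŵ k}
    (subst (λ j → ŵ 0 + ŵ j ≃ ŵ k + ŵ k) (ℕ.n∸n≡0 k) (balance k ℕ.≤-refl))
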